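{- Let $\mathcal{D}$ be a (possibly infinite) strong digraph. Then the infimum of $1-\lambda_S(\gamma)$ taken over all proper cycles $\gamma$ of $\mathcal{D}$ is positive on $\mathcal{S}(\mathcal{D})$ if and only if $\mathcal{D}$ admits a finite cycle transversal and the lengths of all cycles of $\mathcal{D}$ are uniformly bounded above: $$\inf_{\gamma\subset\mathcal{D}}\ \bigl(1-\lambda_S(\gamma)\bigr)>0\quad \forall\, S\in\mathcal{S}(\mathcal{D})\iff |sct(\mathcal{D})|<\infty\ \text{ and }\ \ell_{max}(\mathcal{D})<\infty.$$
   Context: Digraphs have vertex-set $V(\mathcal{D})$ and arc-set $A(\mathcal{D})$, may be infinite, may have loops, but have no multiple arcs. A digraph is strong (strongly connected) if for any pair of distinct vertices $v,w$ there is a path from $v$ to $w$; each vertex of a strong digraph has at least one arc leaving it. A directed cycle is a finite strong digraph in which exactly one arc leaves each vertex (a loop is a cycle of length 1, an undirected edge, i.e. a pair of opposite arcs, is a cycle of length 2); "cycle" always means directed cycle, and $\ell(\gamma)$, the length of $\gamma$, is its number of arcs. A cycle $\gamma$ of $\mathcal{D}$ is proper, written $\gamma\subset\mathcal{D}$, if $\ell(\gamma)<|A(\mathcal{D})|$. $\ell_{max}(\mathcal{D})$ is the length of a longest cycle of $\mathcal{D}$, with $\ell_{max}(\mathcal{D})=\infty$ if cycle lengths are unbounded. A cycle transversal of $\mathcal{D}$ is a set of vertices whose removal (together with all incident arcs) leaves a digraph with no cycles; $|sct(\mathcal{D})|$ is the size of a smallest cycle transversal, and $|sct(\mathcal{D})|=\infty$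 if there is no finite one. A weighting of $\mathcal{D}$ is a positive function on its arcs. It is substochastic if for each vertex the sum of the weights of the arcs leaving it (its out-weight) is not greater than $1$. $\mathcal{S}(\mathcal{D})$ is the class of all substochastic weightings of $\mathcal{D}$. For $S\in\mathcal{S}(\mathcal{D})$ and a cycle $\gamma$ of $\mathcal{D}$, $\lambda_S(\gamma)$ is the spectral radius (Perron root) of the weighted adjacency matrix of $\gamma$ weighted by $S$; it equals $S(\gamma)^{1/\ell(\gamma)}$, where $S(\gamma)$ is the product of the weights of the arcs of $\gamma$.
   Formalization: It is additionally assumed that D admits at least one substochastic weighting; otherwise (e.g. the complete digraph on an uncountable vertex set) the left side is vacuously true while no finite cycle transversal exists. -}

module Defs where

open import Algebra.Bundles using (CommutativeRing)
open import Data.Bool.Base using (if_then_else_)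
open import Data.Fin.Base using (Fin)
open import Data.Fin.Properties using (_≟_)
open import Data.List.Base using (List)
open import Data.List.Membership.Propositional using (_∈_)
open import Data.Nat.Base as ℕ using (ℕ; suc; NonZero)
open import Data.Product.Base using (Σ; ∃; ∃-syntax; ∃₂; _×_; _,_)
open import Data.Refinement.Base using (Refinement-syntax; value)
open import Function.Bundles using (_↣_; Injection)
open import Function.Definitions using (Injective)
open import Level using (Level; 0ℓ; _⊔_) renaming (suc to lsuc)
open import Relation.Binary.Construct.Closure.ReflexiveTransitive using (Star)
open import Relation.Binary.Core using (Rel)
import Relation.Binary.Construct.Add.Supremum.NonStrict as NonStrictSupremum
import Relation.Binary.Construct.Add.Supremum.Strict as StrictSupremum
import Relation.Binary.Construct.NonStrictToStrict as ToStrict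
open import Relation.Binary.Definitions using (Irrelevant)
open import Relation.Binary.PropositionalEquality.Core using (_≡_; _≢_)
open import Relation.Binary.Structures using (IsTotalOrder)
open import Relation.Nullary.Construct.Add.Supremum using (_⁺; [_])
open import Relation.Nullary.Decidable.Core using (does)
open import Relation.Nullary.Negation.Core using (¬_)
open import Relation.Unary using (Pred)
import Algebra.Properties.CommutativeMonoid.Sum as FiniteSum
import Axiom.UniquenessOfIdentityProofs as UIP

------------------------------------------------------------------------
-- Real numbers

-- Classically, this structure determines the real numbers up to isomorphism.
-- Completeness is stated for Set-valued predicates; under excluded middle
-- every predicate is equivalent to one of these, whatever its level.

record CompleteOrderedField : Set₁ where
  infix 4 _≤_
  field
    commutativeRing : CommutativeRing 0ℓ 0ℓ

  open CommutativeRing commutativeRing public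

  field
    _≤_          : Rel Carrier 0ℓ
    isTotalOrder : IsTotalOrder _≈_ _≤_
    +-monoˡ-≤    : ∀ z {x y} → x ≤ y → x + z ≤ y + z
    *-nonNeg     : ∀ {x y} → 0# ≤ x → 0# ≤ y → 0# ≤ x * y
    0≉1          : ¬ 0# ≈ 1#
    inverse      : ∀ x → ¬ x ≈ 0# → ∃[ y ] x * y ≈ 1#

  UpperBound : Pred Carrier 0ℓ → Carrier → Set
  UpperBound P b = ∀ x → P x → x ≤ b

  field
    complete : (P : Pred Carrier 0ℓ) → ∃ P → ∃ (UpperBound P) →
               ∃[ s ] UpperBound P s × (∀ b → UpperBound P b → s ≤ b)

  open ToStrict _≈_ _≤_ public using (_<_)
  open NonStrictSupremum _≤_ public using (_≤⁺_)
  open StrictSupremum _<_ public using (_<⁺_)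
  open FiniteSum +-commutativeMonoid public using (sum)

  -- Infima are taken in ℝ ∪ {+∞}, so that the infimum of ∅ is +∞.

  IsInfimum : ∀ {p} → Pred Carrier p → Carrier ⁺ → Set p
  IsInfimum P m = LowerBound m × (∀ b → LowerBound b → b ≤⁺ m)
    where
    LowerBound : Carrier ⁺ → Set _
    LowerBound b = ∀ x → P x → b ≤⁺ [ x ]

------------------------------------------------------------------------
-- Digraphs

record Digraph (v a : Level) : Set (lsuc (v ⊔ a)) where
  infix 4 _⟶_
  field
    Vertex           : Set v
    _⟶_              : Rel Vertex a
    no-multiple-arcs : Irrelevant _⟶_

  OutArc : Vertex → Set (v ⊔ a)
  OutArc u = ∃[ w ] u ⟶ w

  Arc : Set (v ⊔ a)
  Arc = ∃₂ _⟶_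

Strong : ∀ {v a} → Digraph v a → Set (v ⊔ a)
Strong D = ∀ v w → v ≢ w → Star _⟶_ v w
  where open Digraph D

functional : ∀ {n} → (Fin n → Fin n) → Digraph 0ℓ 0ℓ
functional {n} next = record
  { Vertex           = Fin n
  ; _⟶_              = λ i j → next i ≡ j
  ; no-multiple-arcs = UIP.Decidable⇒UIP.≡-irrelevant _≟_
  }

-- A cycle is a nonempty finite strong subdigraph in which exactly one arc
-- leaves each vertex i, namely the one to next i; hence it has as many arcs
-- as vertices.

record Cycle {v a} (D : Digraph v a) : Set (v ⊔ a) where
  open Digraph D
  field
    length     : ℕ
    nonempty   : NonZero length
    vertex     : Fin length → Vertex
    injective  : Injective _≡_ _≡_ vertex
    next       : Fin length → Fin length
    arc        : ∀ i → vertex i ⟶ vertex (next i)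
    strong     : Strong (functional next)

-- length γ < |A(D)|, where A(D) may be infinite.

Proper : ∀ {v a} {D : Digraph v a} → Cycle D → Set (v ⊔ a)
Proper {D = D} γ = Fin (suc (Cycle.length γ)) ↣ Digraph.Arc D

BoundedCycleLengths : ∀ {v a} → Digraph v a → Set (v ⊔ a)
BoundedCycleLengths D = ∃[ L ] ∀ (γ : Cycle D) → Cycle.length γ ℕ.≤ L

-- Membership in the remaining vertex-set is proof-irrelevant, so that
-- its elements are equal as soon as they are equal as vertices of D.

_∖_ : ∀ {v a p} (D : Digraph v a) → Pred (Digraph.Vertex D) p → Digraph (v ⊔ p) a
D ∖ T = record
  { Vertex           = [ v ∈ Vertex ∣ ¬ T v ]
  ; _⟶_              = λ v w → value v ⟶ value w
  ; no-multiple-arcs = no-multiple-arcs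
  }
  where open Digraph D

CycleTransversal : ∀ {v a p} (D : Digraph v a) → Pred (Digraph.Vertex D) p → Set (v ⊔ a ⊔ p)
CycleTransversal D T = ¬ Cycle (D ∖ T)

HasFiniteCycleTransversal : ∀ {v a} → Digraph v a → Set (v ⊔ a)
HasFiniteCycleTransversal D =
  Σ (List (Digraph.Vertex D)) λ T → CycleTransversal D (_∈ T)

------------------------------------------------------------------------
-- Weightings and spectral radii

module _ (ℝ : CompleteOrderedField) where

  open CompleteOrderedField ℝ

  -- The out-weight of u is the supremum of the sums of weights over finite
  -- sets of arcs leaving u.  Since weights are positive, D has no such
  -- weighting when uncountably many arcs leave some vertex.

  record SubstochasticWeighting {v a} (D : Digraph v a) : Set (v ⊔ a) where
    open Digraph D
    field
      weight        : ∀ {u w} → u ⟶ w → Carrier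
      positive      : ∀ {u w} (e : u ⟶ w) → 0# < weight e
      substochastic : ∀ u n (arcs : Fin n ↣ OutArc u) →
                      sum (λ i → let (_ , e) = Injection.to arcs i in weight e) ≤ 1#

  Matrix : ℕ → Set
  Matrix n = Fin n → Fin n → Carrier

  _·_ : ∀ {n} → Matrix n → (Fin n → Carrier) → (Fin n → Carrier)
  (A · x) i = sum (λ j → A i j * x j)

  -- a + b𝕚 is a complex eigenvalue of the real matrix A, with eigenvector
  -- x + y𝕚.

  IsEigenvalue : ∀ {n} → Matrix n → Carrier → Carrier → Set
  IsEigenvalue {n} A a b =
    Σ (Fin n → Carrier) λ x → Σ (Fin n → Carrier) λ y →
      ¬ (∀ i → x i ≈ 0# × y i ≈ 0#) ×
      (∀ i → (A · x) i ≈ a * x i - b * y i) ×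
      (∀ i → (A · y) i ≈ a * y i + b * x i)

  IsSpectralRadius : ∀ {n} → Matrix n → Carrier → Set
  IsSpectralRadius A r =
    0# ≤ r ×
    (∃₂ λ a b → IsEigenvalue A a b × a * a + b * b ≈ r * r) ×
    (∀ a b → IsEigenvalue A a b → a * a + b * b ≤ r * r)

  module _ {v a} {D : Digraph v a} (S : SubstochasticWeighting D) where

    open SubstochasticWeighting S

    weightedAdjacency : (γ : Cycle D) → Matrix (Cycle.length γ)
    weightedAdjacency γ i j = if does (next i ≟ j) then weight (arc i) else 0#
      where open Cycle γ

    ProperCycleGap : Pred Carrier (v ⊔ a)
    ProperCycleGap x =
      Σ (Cycle D) λ γ → Proper γ ×
        ∃[ r ] IsSpectralRadius (weightedAdjacency γ) r × x ≈ 1# - r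

    PositiveProperCycleGap : Set (v ⊔ a)
    PositiveProperCycleGap = ∃[ m ] IsInfimum ProperCycleGap m × [ 0# ] <⁺ m

-- A substochastic S has at most one arc of weight > ½ leaving each vertex, so
-- at most one cycle through a given vertex t consists of such arcs only, and
-- if proper this cycle has an arc of weight < 1: one more arc must leave it.
-- Hence, given a finite transversal, all proper cycles have an arc of weight at
-- most some fixed β < 1, and λ_S(γ) ≤ β^(1/ℓ(γ)) is bounded away from 1 when
-- ℓ(γ) is bounded.
--
-- Conversely, choose cycles γ₀, γ₁, … such that γₘ either avoids the set Tₘ of
-- vertices of its predecessors (if there is no finite transversal) or is very
-- long compared with Tₘ (if lengths are unbounded).  Let S give weight about
-- 1 - εₘ to the arcs of γₘ outside Tₘ and weight at least some cₘ > 0, known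
-- in advance, to those leaving Tₘ.  Then λ_S(γₘ) ≥ (1 - εₘ)² → 1.
module Submission where

open import Defs
open import Algebra.Bundles using (CommutativeSemiring)
open import Axiom.ExcludedMiddle using (ExcludedMiddle)
open import Data.Bool.Base using (if_then_else_)
open import Data.Fin.Base as Fin using (Fin; zero; suc; toℕ; fromℕ<)
import Data.Fin.Properties as Fin
open import Data.Irrelevant using ([_])
open import Data.List.Base as List using (List; []; _∷_; _++_)
open import Data.List.Membership.Propositional using (_∈_)
open import Data.List.Membership.Propositional.Properties using (∈-++⁺ˡ; ∈-++⁺ʳ; ∈-tabulate⁺)
open import Data.List.Relation.Unary.Any using (here; there)
open import Data.Nat.Base as ℕ using (ℕ; zero; suc; NonZero; z≤n; s≤s)
import Data.Nat.Properties as ℕ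
open import Data.Product.Base using (Σ; ∃; ∃-syntax; _×_; _,_; proj₁; proj₂)
open import Data.Refinement.Base using (value; _,_)
open import Data.Refinement.Properties using (value-injective)
open import Data.Sum.Base using (_⊎_; inj₁; inj₂)
open import Function.Bundles using (_⇔_; mk⇔; _↣_; mk↣; Injection)
open import Function.Definitions using (Injective)
open import Level using (_⊔_)
open import Relation.Binary.Bundles using (Poset)
open import Relation.Binary.Construct.Add.Supremum.NonStrict using ([_]; _≤⊤⁺)
import Relation.Binary.Construct.Add.Supremum.Strict as Strict
open import Relation.Binary.Construct.Closure.ReflexiveTransitive as Star using (Star; _◅_)
import Relation.Binary.Construct.NonStrictToStrict as ToStrict
open import Relation.Binary.Definitions using (tri<; tri≈; tri>)
open import Relation.Binary.PropositionalEquality as ≡ using (_≡_; _≢_)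
import Relation.Binary.Reasoning.PartialOrder as PosetReasoning
open import Relation.Binary.Structures using (IsTotalOrder)
open import Relation.Nullary.Construct.Add.Supremum using (⊤⁺; [_])
open import Relation.Nullary.Decidable.Core
  using (Dec; yes; no; does; True; toWitness; fromWitness; decidable-stable)
open import Relation.Nullary.Negation.Core using (¬_; contradiction; contradiction-irr)
open import Relation.Unary using (Pred)

-- The obstacle in the converse is a circle: how long `γ m` must be depends on the weights leaving
-- the vertices already used, and those weights must grant something to `γ m`, which is not chosen
-- yet. The circle is broken by reserving, at every vertex, a fixed share `ε m` of a distribution
-- over all cycles for `γ m`, whichever cycle that turns out to be. The guaranteed weight `c m` then
-- depends on `m` alone, so the whole sequence of cycles can be chosen first, and a single weighting
-- `S` is defined afterwards, vertex by vertex, with the entire sequence in view. The given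
-- weighting `S₀` keeps `S` positive on the arcs that lie on no chosen cycle. The converse also
-- needs spectral radii to exist, since the infimum ranges over actual radii; hence the construction
-- of n-th roots from completeness and of an explicit Perron vector for a weighted cycle.

least : ∀ {p} (P : ℕ → Set p) → (∀ n → Dec (P n)) → ∃ P → ∃[ m ] P m × (∀ n → P n → m ℕ.≤ n)
least P P? (zero  , P0) = 0 , P0 , λ _ _ → z≤n
least P P? (suc n , Pn) with P? 0 | least (λ k → P (suc k)) (λ k → P? (suc k)) (n , Pn)
... | yes P0 | _                = 0 , P0 , λ _ _ → z≤n
... | no ¬P0 | m , Pm , minimal = suc m , Pm , λ where
  zero    P0 → contradiction P0 ¬P0
  (suc k) Pk → s≤s (minimal k Pk)

upperBound : ∀ n (f : Fin n → ℕ) → ∃[ N ] ∀ i → f i ℕ.≤ N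
upperBound zero    f = 0 , λ ()
upperBound (suc n) f with upperBound n (λ i → f (suc i))
... | N , f≤N = f zero ℕ.⊔ N , λ where
  zero    → ℕ.m≤m⊔n (f zero) N
  (suc i) → ℕ.≤-trans (f≤N i) (ℕ.m≤n⊔m (f zero) N)

IsFirst : ∀ {p} → (ℕ → Set p) → ℕ → Set p
IsFirst P m = P m × (∀ n → P n → m ℕ.≤ n)

-- Used to count visits: each vertex of a cycle found in a list uses up one entry, so a cycle visits
-- the list at most as often as the list is long, even if the list has repetitions.
remove : ∀ {a} {A : Set a} {x : A} {xs : List A} → x ∈ xs →
  ∃[ ys ] List.length xs ≡ suc (List.length ys) × (∀ {y} → y ∈ xs → y ≢ x → y ∈ ys)
remove {xs = x ∷ xs} (here ≡.refl) = xs , ≡.refl , λ where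
  (here y≡x)   y≢x → contradiction y≡x y≢x
  (there y∈xs) _   → y∈xs
remove {xs = z ∷ xs} (there x∈xs) with remove x∈xs
... | ys , eq , xs∖x⊆ys = z ∷ ys , ≡.cong suc eq , λ where
  (here y≡z)   _   → here y≡z
  (there y∈xs) y≢x → there (xs∖x⊆ys y∈xs y≢x)

-- Iterates of a map whose functional digraph is strong: every orbit has period n.

module Orbit {n} (next : Fin n → Fin n) where

  open ≡ using (refl; sym; trans; cong; subst)

  step : ℕ → Fin n → Fin n
  step zero    i = i
  step (suc k) i = step k (next i)

  step-+ : ∀ a b i → step (a ℕ.+ b) i ≡ step b (step a i)
  step-+ zero    b i = refl
  step-+ (suc a) b i = step-+ a b (next i)

  step-+-cong : ∀ a b c {i j} → step a i ≡ step b j → step (a ℕ.+ c) i ≡ step (b ℕ.+ c) j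
  step-+-cong a b c {i} {j} eq =
    trans (step-+ a c i) (trans (cong (step c) eq) (sym (step-+ b c j)))

  step-next : ∀ k i → step k (next i) ≡ next (step k i)
  step-next zero    i = refl
  step-next (suc k) i = step-next k (next i)

  Star⇒step : ∀ {i j} → Star (Digraph._⟶_ (functional next)) i j → ∃[ k ] step k i ≡ j
  Star⇒step Star.ε = 0 , refl
  Star⇒step (refl ◅ p) with Star⇒step p
  ... | k , eq = suc k , eq

  module _ (strong : Strong (functional next)) where

    step-reaches : ∀ i j → ∃[ k ] step k i ≡ j
    step-reaches i j with i Fin.≟ j
    ... | yes i≡j = 0 , i≡j
    ... | no  i≢j = Star⇒step (strong i j i≢j)

    module _ (i : Fin n) where

      private
        Returns : ℕ → Set
        Returns p = step (suc p) i ≡ i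

        least-return : ∃[ p ] Returns p × (∀ q → Returns q → p ℕ.≤ q)
        -- `Returns p` speaks of `suc p` steps, which makes the period positive; a path from
        -- `next i` back to `i`, possibly empty, is the witness.
        least-return = least Returns (λ p → step (suc p) i Fin.≟ i) (step-reaches (next i) i)

        module _ (p : ℕ) (returns : Returns p) (minimal : ∀ q → Returns q → p ℕ.≤ q) where

          -- After a coincidence at times a < b, the `suc c` steps that lead from time b to the
          -- return at time `suc p` also lead from time a to `i`, giving an earlier return.
          no-repetition : ∀ {a b} → a ℕ.< b → b ℕ.≤ p → ¬ step a i ≡ step b i
          no-repetition {a} {b} a<b b≤p eq = ℕ.<⇒≱ a<b (ℕ.+-cancelʳ-≤ (suc c) b a (begin
            b ℕ.+ suc c   ≡⟨ b+1+c≡1+p ⟩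
            suc p         ≤⟨ s≤s (minimal (a ℕ.+ c) a+c-returns) ⟩
            suc (a ℕ.+ c) ≡⟨ ℕ.+-suc a c ⟨
            a ℕ.+ suc c   ∎))
            where
            open ℕ.≤-Reasoning
            c = p ℕ.∸ b
            b+1+c≡1+p : b ℕ.+ suc c ≡ suc p
            b+1+c≡1+p = trans (ℕ.+-suc b c) (cong suc (ℕ.m+[n∸m]≡n b≤p))
            a+c-returns : Returns (a ℕ.+ c)
            a+c-returns = trans (cong (λ k → step k i) (sym (ℕ.+-suc a c)))
              (trans (step-+-cong a b (suc c) eq) (trans (cong (λ k → step k i) b+1+c≡1+p) returns))

          injective-below : ∀ {a b} → a ℕ.< suc p → b ℕ.< suc p → step a i ≡ step b i → a ≡ b
          injective-below {a} {b} (s≤s a≤p) (s≤s b≤p) eq with ℕ.<-cmp a b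
          ... | tri< a<b _ _ = contradiction eq (no-repetition a<b b≤p)
          ... | tri≈ _ a≡b _ = a≡b
          ... | tri> _ _ b<a = contradiction (sym eq) (no-repetition b<a a≤p)

          -- Reduction modulo the period without division: a counter that goes from `p` back to 0.
          reduce : ∀ k → ∃[ a ] a ℕ.< suc p × step k i ≡ step a i
          reduce zero = 0 , s≤s z≤n , refl
          reduce (suc k) with reduce k
          ... | a , s≤s a≤p , eq with ℕ.m≤n⇒m<n∨m≡n a≤p
          ...   | inj₁ a<p = suc a , s≤s a<p , trans (step-next k i) (trans (cong next eq) (sym (step-next a i)))
          ...   | inj₂ refl = 0 , s≤s z≤n ,
            trans (step-next k i) (trans (cong next eq) (trans (sym (step-next a i)) returns))

          onto : ∀ j → ∃[ a ] a ℕ.< suc p × step a i ≡ j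
          onto j with step-reaches i j
          ... | k , refl with reduce k
          ...   | a , a<1+p , eq = a , a<1+p , sym eq

          -- The first `suc p` iterates are distinct by minimality and exhaust `Fin n` by
          -- strongness; each fact gives an injection, one in either direction.
          1+p≡n : suc p ≡ n
          1+p≡n = ℕ.≤-antisym (Fin.injective⇒≤ f-injective) (Fin.injective⇒≤ g-injective)
            where
            f : Fin (suc p) → Fin n
            f a = step (toℕ a) i

            f-injective : Injective _≡_ _≡_ f
            f-injective eq = Fin.toℕ-injective (injective-below (Fin.toℕ<n _) (Fin.toℕ<n _) eq)

            g : Fin n → Fin (suc p)
            g j = fromℕ< (proj₁ (proj₂ (onto j)))

            f∘g≡id : ∀ j → f (g j) ≡ j
            f∘g≡id j = trans (cong (λ a → step a i) (Fin.toℕ-fromℕ< (proj₁ (proj₂ (onto j))))) (proj₂ (proj₂ (onto j)))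

            g-injective : Injective _≡_ _≡_ g
            g-injective {j} {k} eq = trans (sym (f∘g≡id j)) (trans (cong f eq) (f∘g≡id k))

      step-length : step n i ≡ i
      step-length with least-return
      ... | p , returns , minimal = subst (λ m → step m i ≡ i) (1+p≡n p returns minimal) returns

      step-onto : ∀ j → ∃[ a ] a ℕ.< n × step a i ≡ j
      step-onto j with least-return
      ... | p , returns , minimal =
        subst (λ m → ∃[ a ] a ℕ.< m × step a i ≡ j) (1+p≡n p returns minimal) (onto p returns minimal j)

      step-injective : ∀ {a b} → a ℕ.< n → b ℕ.< n → step a i ≡ step b i → a ≡ b
      step-injective {a} {b} with least-return
      ... | p , returns , minimal =
        subst (λ m → a ℕ.< m → b ℕ.< m → step a i ≡ step b i → a ≡ b)
              (1+p≡n p returns minimal) (injective-below p returns minimal)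

-- Polynomial identities in subtraction-free form.

module SemiringIdentities {c ℓ} (R : CommutativeSemiring c ℓ) where

  open CommutativeSemiring R
  open import Algebra.Solver.Ring.NaturalCoefficients.Default R

  -- For y = -x both products with x + y vanish, which leaves (-x)² = x².
  y*y+x[x+y]≈x*x+y[x+y] : ∀ x y → y * y + x * (x + y) ≈ x * x + y * (x + y)
  y*y+x[x+y]≈x*x+y[x+y] =
    solve 2 (λ x y → y :* y :+ x :* (x :+ y) := x :* x :+ y :* (x :+ y)) refl

  -- Multiplicativity of the complex modulus, with `b′` standing for -b; the last summand is the
  -- part that vanishes under this substitution.
  [ax+b′y]²+[ay+bx]² : ∀ a b b′ x y →
    (a * x + b′ * y) * (a * x + b′ * y) + (a * y + b * x) * (a * y + b * x) ≈
    a * a * (x * x + y * y) + (b * b * (x * x) + b′ * b′ * (y * y)) + (b′ + b) * (a * x * y + a * x * y)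
  [ax+b′y]²+[ay+bx]² = solve 5 (λ a b b′ x y →
    (a :* x :+ b′ :* y) :* (a :* x :+ b′ :* y) :+ (a :* y :+ b :* x) :* (a :* y :+ b :* x) :=
    a :* a :* (x :* x :+ y :* y) :+ (b :* b :* (x :* x) :+ b′ :* b′ :* (y :* y))
      :+ (b′ :+ b) :* (a :* x :* y :+ a :* x :* y)) refl

  w²[x²+y²]≈[wx]²+[wy]² : ∀ w x y → w * w * (x * x + y * y) ≈ w * x * (w * x) + w * y * (w * y)
  w²[x²+y²]≈[wx]²+[wy]² = solve 3 (λ w x y → w :* w :* (x :* x :+ y :* y) := w :* x :* (w :* x) :+ w :* y :* (w :* y)) refl

-- Complete ordered fields: order, powers, the Archimedean property and roots.

module OrderedField (em : ∀ {ℓ} → ExcludedMiddle ℓ) (ℝ : CompleteOrderedField) where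

  open CompleteOrderedField ℝ public hiding (zero)
  open IsTotalOrder isTotalOrder public
    using (antisym; total; isPartialOrder; ≤-respʳ-≈; ≤-respˡ-≈)
    renaming (refl to ≤-refl; trans to ≤-trans; reflexive to ≤-reflexive)
  open ToStrict _≈_ _≤_ public using (<⇒≤)
  open import Algebra.Properties.Semiring.Exp semiring public
    using (_^_; ^-congˡ)
  open import Algebra.Properties.CommutativeSemiring.Exp commutativeSemiring public
    using (^-distrib-*)
  open SemiringIdentities commutativeSemiring

  poset : Poset _ _ _
  poset = record { isPartialOrder = isPartialOrder }

  module ≤-Reasoning = PosetReasoning poset
  open ≤-Reasoning

  <⇒≱ : ∀ {x y} → x < y → ¬ y ≤ x
  <⇒≱ = ToStrict.<⇒≱ _≈_ _≤_ antisym

  ≰⇒> : ∀ {x y} → ¬ x ≤ y → y < x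
  ≰⇒> = ToStrict.≰⇒> _≈_ _≤_ sym ≤-reflexive total

  ≤-or-> : ∀ x y → x ≤ y ⊎ y < x
  ≤-or-> x y with em {P = x ≤ y}
  ... | yes x≤y = inj₁ x≤y
  ... | no  x≰y = inj₂ (≰⇒> x≰y)

  +-monoʳ-≤ : ∀ z {x y} → x ≤ y → z + x ≤ z + y
  +-monoʳ-≤ z {x} {y} x≤y = begin
    z + x ≈⟨ +-comm z x ⟩
    x + z ≤⟨ +-monoˡ-≤ z x≤y ⟩
    y + z ≈⟨ +-comm y z ⟩
    z + y ∎

  +-mono-≤ : ∀ {w x y z} → w ≤ x → y ≤ z → w + y ≤ x + z
  +-mono-≤ w≤x y≤z = ≤-trans (+-monoˡ-≤ _ w≤x) (+-monoʳ-≤ _ y≤z)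

  x+z-z≈x : ∀ x z → (x + z) + - z ≈ x
  x+z-z≈x x z = begin-equality
    (x + z) + - z ≈⟨ +-assoc x z (- z) ⟩
    x + (z + - z) ≈⟨ +-congˡ (-‿inverseʳ z) ⟩
    x + 0#        ≈⟨ +-identityʳ x ⟩
    x             ∎

  +-cancelʳ-≤ : ∀ z {x y} → x + z ≤ y + z → x ≤ y
  +-cancelʳ-≤ z {x} {y} x+z≤y+z = begin
    x             ≈⟨ x+z-z≈x x z ⟨
    (x + z) + - z ≤⟨ +-monoˡ-≤ (- z) x+z≤y+z ⟩
    (y + z) + - z ≈⟨ x+z-z≈x y z ⟩
    y             ∎

  +-cancelˡ-≤ : ∀ z {x y} → z + x ≤ z + y → x ≤ y
  +-cancelˡ-≤ z {x} {y} z+x≤z+y = +-cancelʳ-≤ z (begin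
    x + z ≈⟨ +-comm x z ⟩
    z + x ≤⟨ z+x≤z+y ⟩
    z + y ≈⟨ +-comm z y ⟩
    y + z ∎)

  x≤x+y : ∀ x {y} → 0# ≤ y → x ≤ x + y
  x≤x+y x {y} 0≤y = begin
    x      ≈⟨ +-identityʳ x ⟨
    x + 0# ≤⟨ +-monoʳ-≤ x 0≤y ⟩
    x + y  ∎

  x≤y+x : ∀ x {y} → 0# ≤ y → x ≤ y + x
  x≤y+x x 0≤y = ≤-respʳ-≈ (+-comm x _) (x≤x+y x 0≤y)

  +-nonNeg : ∀ {x y} → 0# ≤ x → 0# ≤ y → 0# ≤ x + y
  +-nonNeg 0≤x 0≤y = ≤-trans 0≤x (x≤x+y _ 0≤y)

  y-x+x≈y : ∀ x y → (y - x) + x ≈ y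
  y-x+x≈y x y = begin-equality
    (y - x) + x   ≈⟨ +-assoc y (- x) x ⟩
    y + (- x + x) ≈⟨ +-congˡ (-‿inverseˡ x) ⟩
    y + 0#        ≈⟨ +-identityʳ y ⟩
    y             ∎

  x≤y⇒0≤y-x : ∀ {x y} → x ≤ y → 0# ≤ y - x
  x≤y⇒0≤y-x {x} {y} x≤y = ≤-respˡ-≈ (-‿inverseʳ x) (+-monoˡ-≤ (- x) x≤y)

  x<y⇒0<y-x : ∀ {x y} → x < y → 0# < y - x
  x<y⇒0<y-x {x} {y} (x≤y , x≉y) = x≤y⇒0≤y-x x≤y , λ 0≈y-x → x≉y (begin-equality
    x           ≈⟨ +-identityˡ x ⟨
    0# + x      ≈⟨ +-congʳ 0≈y-x ⟩
    (y - x) + x ≈⟨ y-x+x≈y x y ⟩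
    y           ∎)

  -‿monoʳ-≤ : ∀ z {x y} → x ≤ y → z - y ≤ z - x
  -‿monoʳ-≤ z {x} {y} x≤y = +-cancelʳ-≤ x (begin
    (z - y) + x ≤⟨ +-monoʳ-≤ (z - y) x≤y ⟩
    (z - y) + y ≈⟨ y-x+x≈y y z ⟩
    z           ≈⟨ y-x+x≈y x z ⟨
    (z - x) + x ∎)

  *-monoʳ-≤ : ∀ {x y z} → 0# ≤ z → x ≤ y → z * x ≤ z * y
  *-monoʳ-≤ {x} {y} {z} 0≤z x≤y = begin
    z * x                     ≤⟨ x≤y+x _ (*-nonNeg 0≤z (x≤y⇒0≤y-x x≤y)) ⟩
    z * (y - x) + z * x       ≈⟨ distribˡ z (y - x) x ⟨
    z * ((y - x) + x)         ≈⟨ *-congˡ (y-x+x≈y x y) ⟩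
    z * y                     ∎

  *-monoˡ-≤ : ∀ {x y z} → 0# ≤ z → x ≤ y → x * z ≤ y * z
  *-monoˡ-≤ {x} {y} {z} 0≤z x≤y = begin
    x * z ≈⟨ *-comm x z ⟩
    z * x ≤⟨ *-monoʳ-≤ 0≤z x≤y ⟩
    z * y ≈⟨ *-comm z y ⟩
    y * z ∎

  *-mono-≤ : ∀ {w x y z} → 0# ≤ w → 0# ≤ z → w ≤ x → y ≤ z → w * y ≤ x * z
  *-mono-≤ 0≤w 0≤z w≤x y≤z = ≤-trans (*-monoʳ-≤ 0≤w y≤z) (*-monoˡ-≤ 0≤z w≤x)

  -x*-x≈x*x : ∀ x → - x * - x ≈ x * x
  -x*-x≈x*x x = begin-equality
    - x * - x                 ≈⟨ +-identityʳ _ ⟨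
    - x * - x + 0#            ≈⟨ +-congˡ (trans (*-congˡ (-‿inverseʳ x)) (zeroʳ x)) ⟨
    - x * - x + x * (x + - x) ≈⟨ y*y+x[x+y]≈x*x+y[x+y] x (- x) ⟩
    x * x + - x * (x + - x)   ≈⟨ +-congˡ (trans (*-congˡ (-‿inverseʳ x)) (zeroʳ (- x))) ⟩
    x * x + 0#                ≈⟨ +-identityʳ _ ⟩
    x * x                     ∎

  x²-nonNeg : ∀ x → 0# ≤ x * x
  x²-nonNeg x with total 0# x
  ... | inj₁ 0≤x = *-nonNeg 0≤x 0≤x
  ... | inj₂ x≤0 = ≤-respʳ-≈ (-x*-x≈x*x x) (*-nonNeg 0≤-x 0≤-x)
    where
    0≤-x : 0# ≤ - x
    0≤-x = ≤-respʳ-≈ (+-identityˡ (- x)) (x≤y⇒0≤y-x x≤0)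

  0≤1 : 0# ≤ 1#
  0≤1 = ≤-respʳ-≈ (*-identityˡ 1#) (x²-nonNeg 1#)

  0<1 : 0# < 1#
  0<1 = 0≤1 , 0≉1

  x*y≈0⇒y≈0 : ∀ {x y} → ¬ x ≈ 0# → x * y ≈ 0# → y ≈ 0#
  x*y≈0⇒y≈0 {x} {y} x≉0 xy≈0 with inverse x x≉0
  ... | z , xz≈1 = begin-equality
    y           ≈⟨ *-identityˡ y ⟨
    1# * y      ≈⟨ *-congʳ xz≈1 ⟨
    (x * z) * y ≈⟨ trans (*-congʳ (*-comm x z)) (*-assoc z x y) ⟩
    z * (x * y) ≈⟨ *-congˡ xy≈0 ⟩
    z * 0#      ≈⟨ zeroʳ z ⟩
    0#          ∎

  *-pos : ∀ {x y} → 0# < x → 0# < y → 0# < x * y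
  *-pos (0≤x , 0≉x) (0≤y , 0≉y) =
    *-nonNeg 0≤x 0≤y , λ 0≈xy → 0≉y (sym (x*y≈0⇒y≈0 (λ x≈0 → 0≉x (sym x≈0)) (sym 0≈xy)))

  *-cancelˡ-≈ : ∀ {x y z} → ¬ z ≈ 0# → z * x ≈ z * y → x ≈ y
  *-cancelˡ-≈ {x} {y} {z} z≉0 zx≈zy with inverse z z≉0
  ... | w , zw≈1 = begin-equality
    x           ≈⟨ shuffle x ⟨
    w * (z * x) ≈⟨ *-congˡ zx≈zy ⟩
    w * (z * y) ≈⟨ shuffle y ⟩
    y           ∎
    where
    shuffle : ∀ u → w * (z * u) ≈ u
    shuffle u = begin-equality
      w * (z * u) ≈⟨ trans (sym (*-assoc w z u)) (*-congʳ (*-comm w z)) ⟩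
      (z * w) * u ≈⟨ *-congʳ zw≈1 ⟩
      1# * u      ≈⟨ *-identityˡ u ⟩
      u           ∎

  *-cancelˡ-≤ : ∀ {x y z} → 0# < z → z * x ≤ z * y → x ≤ y
  *-cancelˡ-≤ {x} {y} {z} (0≤z , 0≉z) zx≤zy with total x y
  ... | inj₁ x≤y = x≤y
  ... | inj₂ y≤x = ≤-reflexive (*-cancelˡ-≈ (λ z≈0 → 0≉z (sym z≈0))
                     (antisym zx≤zy (*-monoʳ-≤ 0≤z y≤x)))

  *-monoʳ-< : ∀ {x y z} → 0# < z → x < y → z * x < z * y
  *-monoʳ-< 0<z x<y = ≰⇒> λ zy≤zx → <⇒≱ x<y (*-cancelˡ-≤ 0<z zy≤zx)

  <-≤-trans : ∀ {x y z} → x < y → y ≤ z → x < z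
  <-≤-trans x<y y≤z = ≰⇒> λ z≤x → <⇒≱ x<y (≤-trans y≤z z≤x)

  ≤-<-trans : ∀ {x y z} → x ≤ y → y < z → x < z
  ≤-<-trans x≤y y<z = ≰⇒> λ z≤x → <⇒≱ y<z (≤-trans z≤x x≤y)

  inverse-pos : ∀ {x} → 0# < x → ∃[ y ] 0# < y × x * y ≈ 1#
  inverse-pos {x} 0<x@(_ , 0≉x) with inverse x (λ x≈0 → 0≉x (sym x≈0))
  ... | y , xy≈1 = y , ≰⇒> y≰0 , xy≈1
    where
    y≰0 : ¬ y ≤ 0#
    y≰0 y≤0 = <⇒≱ 0<1 (begin
      1#     ≈⟨ xy≈1 ⟨
      x * y  ≤⟨ *-monoʳ-≤ (<⇒≤ 0<x) y≤0 ⟩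
      x * 0# ≈⟨ zeroʳ x ⟩
      0#     ∎)

  abstract
    half : ∃[ h ] 0# < h × h + h ≈ 1#
    half with inverse-pos (<-≤-trans 0<1 (x≤x+y 1# 0≤1))
    ... | h , 0<h , 2h≈1 = h , 0<h , (begin-equality
      h + h           ≈⟨ +-cong (*-identityˡ h) (*-identityˡ h) ⟨
      1# * h + 1# * h ≈⟨ distribʳ h 1# 1# ⟨
      (1# + 1#) * h   ≈⟨ 2h≈1 ⟩
      1#              ∎)

  ½ : Carrier
  ½ = proj₁ half

  0<½ : 0# < ½
  0<½ = proj₁ (proj₂ half)

  0≤½ : 0# ≤ ½
  0≤½ = <⇒≤ 0<½

  ½+½≈1 : ½ + ½ ≈ 1#
  ½+½≈1 = proj₂ (proj₂ half)

  ½≤1 : ½ ≤ 1#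
  ½≤1 = ≤-respʳ-≈ ½+½≈1 (x≤x+y ½ 0≤½)

  ½<1 : ½ < 1#
  ½<1 = ½≤1 , λ ½≈1 → proj₂ 0<½ (sym (+-cancel (trans ½+½≈1 (sym ½≈1))))
    where
    +-cancel : ½ + ½ ≈ ½ → ½ ≈ 0#
    +-cancel e = trans (sym (x+z-z≈x ½ ½)) (trans (+-congʳ e) (-‿inverseʳ ½))

  ^-nonNeg : ∀ {x} → 0# ≤ x → ∀ n → 0# ≤ x ^ n
  ^-nonNeg 0≤x zero    = 0≤1
  ^-nonNeg 0≤x (suc n) = *-nonNeg 0≤x (^-nonNeg 0≤x n)

  ^-pos : ∀ {x} → 0# < x → ∀ n → 0# < x ^ n
  ^-pos 0<x zero    = 0<1
  ^-pos 0<x (suc n) = *-pos 0<x (^-pos 0<x n)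

  ^-monoˡ-≤ : ∀ {x y} → 0# ≤ x → x ≤ y → ∀ n → x ^ n ≤ y ^ n
  ^-monoˡ-≤ 0≤x x≤y zero    = ≤-refl
  ^-monoˡ-≤ 0≤x x≤y (suc n) =
    *-mono-≤ 0≤x (^-nonNeg (≤-trans 0≤x x≤y) n) x≤y (^-monoˡ-≤ 0≤x x≤y n)

  ^-≤1 : ∀ {x} → 0# ≤ x → x ≤ 1# → ∀ n → x ^ n ≤ 1#
  ^-≤1 0≤x x≤1 zero    = ≤-refl
  ^-≤1 {x} 0≤x x≤1 (suc n) = begin
    x * x ^ n ≤⟨ *-mono-≤ 0≤x 0≤1 x≤1 (^-≤1 0≤x x≤1 n) ⟩
    1# * 1#   ≈⟨ *-identityˡ 1# ⟩
    1#        ∎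

  ^-antiʳ-≤ : ∀ {x} → 0# ≤ x → x ≤ 1# → ∀ {m n} → m ℕ.≤ n → x ^ n ≤ x ^ m
  ^-antiʳ-≤ 0≤x x≤1 {n = n} z≤n = ^-≤1 0≤x x≤1 n
  ^-antiʳ-≤ 0≤x x≤1 (s≤s m≤n)    = *-monoʳ-≤ 0≤x (^-antiʳ-≤ 0≤x x≤1 m≤n)

  ^-cancel-≤ : ∀ {x y} → 0# ≤ x → 0# ≤ y → ∀ n .{{_ : NonZero n}} → x ^ n ≤ y ^ n → x ≤ y
  ^-cancel-≤ {x} {y} 0≤x 0≤y (suc n) xⁿ≤yⁿ with ≤-or-> x y
  ... | inj₁ x≤y = x≤y
  ... | inj₂ y<x = contradiction xⁿ≤yⁿ (<⇒≱ (begin-strict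
    y * y ^ n ≤⟨ *-monoʳ-≤ 0≤y (^-monoˡ-≤ 0≤y (<⇒≤ y<x) n) ⟩
    y * x ^ n ≈⟨ *-comm _ _ ⟩
    x ^ n * y <⟨ *-monoʳ-< (^-pos (≤-<-trans 0≤y y<x) n) y<x ⟩
    x ^ n * x ≈⟨ *-comm _ _ ⟩
    x * x ^ n ∎))

  ^-cancel-≈ : ∀ {x y} → 0# ≤ x → 0# ≤ y → ∀ n .{{_ : NonZero n}} → x ^ n ≈ y ^ n → x ≈ y
  ^-cancel-≈ 0≤x 0≤y n eq = antisym
    (^-cancel-≤ 0≤x 0≤y n (≤-reflexive eq)) (^-cancel-≤ 0≤y 0≤x n (≤-reflexive (sym eq)))

  x²≈y²⇒x≈y : ∀ {x y} → 0# ≤ x → 0# ≤ y → x * x ≈ y * y → x ≈ y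
  x²≈y²⇒x≈y {x} {y} 0≤x 0≤y eq = ^-cancel-≈ 0≤x 0≤y 2 (begin-equality
    x * (x * 1#) ≈⟨ *-congˡ (*-identityʳ x) ⟩
    x * x        ≈⟨ eq ⟩
    y * y        ≈⟨ *-congˡ (*-identityʳ y) ⟨
    y * (y * 1#) ∎)

  1^n≈1 : ∀ n → 1# ^ n ≈ 1#
  1^n≈1 zero    = refl
  1^n≈1 (suc n) = trans (*-identityˡ _) (1^n≈1 n)

  -- If s is the supremum of a set closed under division by ρ, then ρ s is again
  -- an upper bound, so s ≤ ρ s.
  x≤ρx⇒x≤0 : ∀ {x ρ} → ρ < 1# → x ≤ ρ * x → x ≤ 0#
  x≤ρx⇒x≤0 {x} {ρ} ρ<1 x≤ρx with ≤-or-> x 0#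
  ... | inj₁ x≤0 = x≤0
  ... | inj₂ 0<x = contradiction x≤ρx (<⇒≱ (begin-strict
    ρ * x  ≈⟨ *-comm ρ x ⟩
    x * ρ  <⟨ *-monoʳ-< 0<x ρ<1 ⟩
    x * 1# ≈⟨ *-identityʳ x ⟩
    x      ∎))

  -- The infimum of the powers is obtained as the supremum of the set `A` of their lower bounds. If
  -- no power were at most `c`, then `c` would lie in `A`; but division by `q` maps `A` into itself,
  -- which forces the supremum to be at most 0.
  ^-archimedean : ∀ {q c} → 0# < q → q < 1# → 0# < c → ∃[ n ] q ^ n ≤ c
  ^-archimedean {q} {c} 0<q q<1 0<c with em {P = ∃[ n ] q ^ n ≤ c}
  ... | yes ∃n = ∃n
  ... | no ∄n = contradiction (≤-trans (ub c c∈A) (x≤ρx⇒x≤0 q<1 (lub (q * s) q*s-ub))) (<⇒≱ 0<c)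
    where
    A : Carrier → Set
    A x = ∀ n → x ≤ q ^ n

    c∈A : A c
    c∈A n with total c (q ^ n)
    ... | inj₁ c≤qⁿ = c≤qⁿ
    ... | inj₂ qⁿ≤c = contradiction (n , qⁿ≤c) ∄n

    A-complete = complete A (c , c∈A) (1# , λ x x∈A → x∈A 0)
    s   = proj₁ A-complete
    ub  = proj₁ (proj₂ A-complete)
    lub = proj₂ (proj₂ A-complete)

    q*s-ub : UpperBound A (q * s)
    q*s-ub x x∈A with inverse-pos 0<q
    ... | q⁻¹ , 0<q⁻¹ , qq⁻¹≈1 = begin
      x             ≈⟨ *-identityˡ x ⟨
      1# * x        ≈⟨ *-congʳ qq⁻¹≈1 ⟨
      q * q⁻¹ * x   ≈⟨ *-assoc q q⁻¹ x ⟩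
      q * (q⁻¹ * x) ≤⟨ *-monoʳ-≤ (<⇒≤ 0<q) (ub (q⁻¹ * x) q⁻¹x∈A) ⟩
      q * s         ∎
      where
      q⁻¹x∈A : A (q⁻¹ * x)
      q⁻¹x∈A n = *-cancelˡ-≤ 0<q (begin
        q * (q⁻¹ * x) ≈⟨ *-assoc q q⁻¹ x ⟨
        q * q⁻¹ * x   ≈⟨ *-congʳ qq⁻¹≈1 ⟩
        1# * x        ≈⟨ *-identityˡ x ⟩
        x             ≤⟨ x∈A (suc n) ⟩
        q * q ^ n     ∎)

  max : ∀ x y → ∃[ z ] x ≤ z × y ≤ z × (∀ {b} → x < b → y < b → z < b)
  max x y with total x y
  ... | inj₁ x≤y = y , x≤y , ≤-refl , λ _ y<b → y<b
  ... | inj₂ y≤x = x , ≤-refl , y≤x , λ x<b _ → x<b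

  midpoint : ∀ {x y} → x < y → ∃[ m ] x < m × m < y
  midpoint {x} {y} x<y = ½ * (x + y) , left , right
    where
    double : ∀ z → z ≈ ½ * (z + z)
    double z = begin-equality
      z           ≈⟨ *-identityˡ z ⟨
      1# * z      ≈⟨ *-congʳ ½+½≈1 ⟨
      (½ + ½) * z ≈⟨ trans (distribʳ z ½ ½) (sym (distribˡ ½ z z)) ⟩
      ½ * (z + z) ∎

    left : x < ½ * (x + y)
    left = begin-strict
      x           ≈⟨ double x ⟩
      ½ * (x + x) <⟨ *-monoʳ-< 0<½ (≰⇒> λ h → <⇒≱ x<y (+-cancelˡ-≤ x h)) ⟩
      ½ * (x + y) ∎

    right : ½ * (x + y) < y
    right = begin-strict
      ½ * (x + y) <⟨ *-monoʳ-< 0<½ (≰⇒> λ h → <⇒≱ x<y (+-cancelʳ-≤ y h)) ⟩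
      ½ * (y + y) ≈⟨ double y ⟨
      y           ∎

  ratio : ∀ {a b} → 0# ≤ a → a < b → ∃[ ρ ] 0# < ρ × ρ < 1# × a ≤ ρ * b
  ratio {a} {b} 0≤a a<b with inverse-pos (≤-<-trans 0≤a a<b)
  -- The maximum with `½` keeps ρ positive when a = 0.
  ... | b⁻¹ , 0<b⁻¹ , bb⁻¹≈1 with max ½ (a * b⁻¹)
  ...   | ρ , ½≤ρ , a/b≤ρ , lub = ρ , <-≤-trans 0<½ ½≤ρ , lub ½<1 a/b<1 , (begin
    a             ≈⟨ *-identityʳ a ⟨
    a * 1#        ≈⟨ *-congˡ bb⁻¹≈1 ⟨
    a * (b * b⁻¹) ≈⟨ trans (*-congˡ (*-comm b b⁻¹)) (sym (*-assoc a b⁻¹ b)) ⟩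
    a * b⁻¹ * b   ≤⟨ *-monoˡ-≤ (≤-trans 0≤a (<⇒≤ a<b)) a/b≤ρ ⟩
    ρ * b         ∎)
    where
    a/b<1 : a * b⁻¹ < 1#
    a/b<1 = begin-strict
      a * b⁻¹ ≈⟨ *-comm a b⁻¹ ⟩
      b⁻¹ * a <⟨ *-monoʳ-< 0<b⁻¹ a<b ⟩
      b⁻¹ * b ≈⟨ *-comm b⁻¹ b ⟩
      b * b⁻¹ ≈⟨ bb⁻¹≈1 ⟩
      1#      ∎

  abstract
    -- Takes the place of continuity of the n-th power at 1: a midpoint splits the gap between a and
    -- b, one factor ρ is spent on the lower part and the induction hypothesis on the upper part.
    ^-ratio : ∀ n {a b} → 0# ≤ a → a < b → ∃[ ρ ] 0# < ρ × ρ < 1# × a ≤ ρ ^ n * b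
    ^-ratio zero {a} {b} 0≤a a<b = ½ , 0<½ , ½<1 , ≤-respʳ-≈ (sym (*-identityˡ b)) (<⇒≤ a<b)
    ^-ratio (suc n) {a} {b} 0≤a a<b with midpoint a<b
    ... | m , a<m , m<b with ratio 0≤a a<m | ^-ratio n (≤-trans 0≤a (<⇒≤ a<m)) m<b
    ...   | ρ₁ , 0<ρ₁ , ρ₁<1 , a≤ρ₁m | ρ₂ , 0<ρ₂ , ρ₂<1 , m≤ρ₂ⁿb with max ρ₁ ρ₂
    ...     | ρ , ρ₁≤ρ , ρ₂≤ρ , lub = ρ , 0<ρ , lub ρ₁<1 ρ₂<1 , (begin
      a                ≤⟨ a≤ρ₁m ⟩
      ρ₁ * m           ≤⟨ *-mono-≤ (<⇒≤ 0<ρ₁) (*-nonNeg (^-nonNeg (<⇒≤ 0<ρ) n) 0≤b) ρ₁≤ρ m≤ρⁿb ⟩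
      ρ * (ρ ^ n * b)  ≈⟨ *-assoc ρ (ρ ^ n) b ⟨
      ρ * ρ ^ n * b    ∎)
      where
      0<ρ : 0# < ρ
      0<ρ = <-≤-trans 0<ρ₁ ρ₁≤ρ
      0≤b : 0# ≤ b
      0≤b = ≤-trans 0≤a (<⇒≤ a<b)
      m≤ρⁿb : m ≤ ρ ^ n * b
      m≤ρⁿb = ≤-trans m≤ρ₂ⁿb (*-monoˡ-≤ 0≤b (^-monoˡ-≤ (<⇒≤ 0<ρ₂) ρ₂≤ρ n))

  module _ (n : ℕ) {c : Carrier} (0≤c : 0# ≤ c) (c≤1 : c ≤ 1#) where

    private
      PowerBelow : Carrier → Set
      PowerBelow x = 0# ≤ x × x ^ suc n ≤ c

      c-below : PowerBelow c
      c-below = 0≤c , (begin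
        c * c ^ n ≤⟨ *-monoʳ-≤ 0≤c (^-≤1 0≤c c≤1 n) ⟩
        c * 1#    ≈⟨ *-identityʳ c ⟩
        c         ∎)

      below-bounded : UpperBound PowerBelow 1#
      below-bounded x (0≤x , xᵏ≤c) = ^-cancel-≤ 0≤x 0≤1 (suc n) (begin
        x ^ suc n  ≤⟨ xᵏ≤c ⟩
        c          ≤⟨ c≤1 ⟩
        1#         ≈⟨ 1^n≈1 (suc n) ⟨
        1# ^ suc n ∎)

      module _ (s : Carrier) (ub : UpperBound PowerBelow s)
               (lub : ∀ b → UpperBound PowerBelow b → s ≤ b) where

        0≤s : 0# ≤ s
        0≤s = ≤-trans 0≤c (ub c c-below)

        s≤0⇒sᵏ≤0 : s ≤ 0# → s ^ suc n ≤ 0#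
        s≤0⇒sᵏ≤0 s≤0 = begin
          s * s ^ n  ≤⟨ *-monoˡ-≤ (^-nonNeg 0≤s n) s≤0 ⟩
          0# * s ^ n ≈⟨ zeroˡ _ ⟩
          0#         ∎

        ρs-ub : ∀ {ρ} → 0# < ρ → c ≤ ρ ^ suc n * s ^ suc n → UpperBound PowerBelow (ρ * s)
        ρs-ub {ρ} 0<ρ c≤ρᵏsᵏ x (0≤x , xᵏ≤c) = ^-cancel-≤ 0≤x (*-nonNeg (<⇒≤ 0<ρ) 0≤s) (suc n) (begin
          x ^ suc n             ≤⟨ xᵏ≤c ⟩
          c                     ≤⟨ c≤ρᵏsᵏ ⟩
          ρ ^ suc n * s ^ suc n ≈⟨ ^-distrib-* ρ s (suc n) ⟨
          (ρ * s) ^ suc n       ∎)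

        s≤ρs : ∀ {ρ} → 0# < ρ → s ^ suc n ≤ ρ ^ suc n * c → s ≤ ρ * s
        s≤ρs {ρ} 0<ρ sᵏ≤ρᵏc with inverse-pos 0<ρ
        ... | ρ⁻¹ , 0<ρ⁻¹ , ρρ⁻¹≈1 = begin
          s             ≈⟨ ρρ⁻¹s≈s ⟨
          ρ * (ρ⁻¹ * s) ≤⟨ *-monoʳ-≤ (<⇒≤ 0<ρ) (ub _ ρ⁻¹s-below) ⟩
          ρ * s         ∎
          where
          ρρ⁻¹s≈s : ρ * (ρ⁻¹ * s) ≈ s
          ρρ⁻¹s≈s = trans (sym (*-assoc ρ ρ⁻¹ s)) (trans (*-congʳ ρρ⁻¹≈1) (*-identityˡ s))

          ρ⁻¹s-below : PowerBelow (ρ⁻¹ * s)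
          ρ⁻¹s-below = *-nonNeg (<⇒≤ 0<ρ⁻¹) 0≤s , *-cancelˡ-≤ (^-pos 0<ρ (suc n)) (begin
            ρ ^ suc n * (ρ⁻¹ * s) ^ suc n ≈⟨ ^-distrib-* ρ (ρ⁻¹ * s) (suc n) ⟨
            (ρ * (ρ⁻¹ * s)) ^ suc n       ≈⟨ ^-congˡ (suc n) ρρ⁻¹s≈s ⟩
            s ^ suc n                     ≤⟨ sᵏ≤ρᵏc ⟩
            ρ ^ suc n * c                 ∎)

        -- The root is the supremum `s` of `PowerBelow`. If its power exceeds `c`, some ρ < 1 makes
        -- ρs an upper bound; if its power falls short of `c`, then s/ρ still belongs to the set.
        -- Either way s ≤ ρs, hence s ≤ 0, and the desired inequality follows from this and 0 ≤ c.
        sᵏ≤c : s ^ suc n ≤ c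
        sᵏ≤c with ≤-or-> (s ^ suc n) c
        ... | inj₁ sᵏ≤c = sᵏ≤c
        ... | inj₂ c<sᵏ with ^-ratio (suc n) 0≤c c<sᵏ
        ...   | ρ , 0<ρ , ρ<1 , c≤ρᵏsᵏ =
          ≤-trans (s≤0⇒sᵏ≤0 (x≤ρx⇒x≤0 ρ<1 (lub (ρ * s) (ρs-ub 0<ρ c≤ρᵏsᵏ)))) 0≤c

        c≤sᵏ : c ≤ s ^ suc n
        c≤sᵏ with ≤-or-> c (s ^ suc n)
        ... | inj₁ c≤sᵏ = c≤sᵏ
        ... | inj₂ sᵏ<c with ^-ratio (suc n) (^-nonNeg 0≤s (suc n)) sᵏ<c
        ...   | ρ , 0<ρ , ρ<1 , sᵏ≤ρᵏc =
          ≤-trans (≤-trans (ub c c-below) (x≤ρx⇒x≤0 ρ<1 (s≤ρs 0<ρ sᵏ≤ρᵏc))) (^-nonNeg 0≤s (suc n))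

    root-suc : ∃[ r ] 0# ≤ r × r ^ suc n ≈ c
    root-suc with complete PowerBelow (c , c-below) (1# , below-bounded)
    ... | s , ub , lub = s , 0≤s s ub lub , antisym (sᵏ≤c s ub lub) (c≤sᵏ s ub lub)

  root : ∀ n .{{_ : NonZero n}} {c} → 0# ≤ c → c ≤ 1# → ∃[ r ] 0# ≤ r × r ^ n ≈ c
  root (suc n) = root-suc n

-- The spectral radius of a weighted cycle.

module Spectral (em : ∀ {ℓ} → ExcludedMiddle ℓ) (ℝ : CompleteOrderedField) where

  open OrderedField em ℝ
  open SemiringIdentities commutativeSemiring
  open import Algebra.Properties.CommutativeSemigroup *-commutativeSemigroup
    using (x∙yz≈y∙xz) renaming (interchange to *-interchange)
  open import Algebra.Properties.Ring ring using (-‿distribˡ-*)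
  open ≤-Reasoning

  sum-zero : ∀ {n} (f : Fin n → Carrier) → (∀ i → f i ≈ 0#) → sum f ≈ 0#
  sum-zero {zero}  f f≈0 = refl
  sum-zero {suc n} f f≈0 =
    trans (+-cong (f≈0 zero) (sum-zero (λ i → f (suc i)) (λ i → f≈0 (suc i)))) (+-identityˡ 0#)

  sum-single : ∀ {n} (k : Fin n) c (x : Fin n → Carrier) →
    sum (λ j → (if does (k Fin.≟ j) then c else 0#) * x j) ≈ c * x k
  sum-single zero c x =
    trans (+-congˡ (sum-zero _ (λ j → zeroˡ (x (suc j))))) (+-identityʳ _)
  sum-single (suc k) c x =
    trans (+-cong (zeroˡ _) (sum-single k c (λ j → x (suc j)))) (+-identityˡ _)

  x²≈0⇒x≈0 : ∀ {x} → x * x ≈ 0# → x ≈ 0#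
  x²≈0⇒x≈0 {x} xx≈0 with em {P = x ≈ 0#}
  ... | yes x≈0 = x≈0
  ... | no  x≉0 = x*y≈0⇒y≈0 x≉0 xx≈0

  x²+y²≈0⇒x≈0 : ∀ {x y} → x * x + y * y ≈ 0# → x ≈ 0#
  x²+y²≈0⇒x≈0 {x} {y} eq =
    x²≈0⇒x≈0 (antisym (≤-trans (x≤x+y _ (x²-nonNeg y)) (≤-reflexive eq)) (x²-nonNeg x))

  |az|²≈|a|²|z|² : ∀ a b x y →
    (a * x - b * y) * (a * x - b * y) + (a * y + b * x) * (a * y + b * x) ≈
    (a * a + b * b) * (x * x + y * y)
  |az|²≈|a|²|z|² a b x y = begin-equality
    (a * x - b * y) * (a * x - b * y) + (a * y + b * x) * (a * y + b * x)
      ≈⟨ +-congʳ (*-cong e e) ⟩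
    (a * x + - b * y) * (a * x + - b * y) + (a * y + b * x) * (a * y + b * x)
      ≈⟨ [ax+b′y]²+[ay+bx]² a b (- b) x y ⟩
    a * a * (x * x + y * y) + (b * b * (x * x) + - b * - b * (y * y)) + (- b + b) * (a * x * y + a * x * y)
      ≈⟨ +-cong (+-congˡ (+-congˡ (*-congʳ (-x*-x≈x*x b)))) (trans (*-congʳ (-‿inverseˡ b)) (zeroˡ _)) ⟩
    a * a * (x * x + y * y) + (b * b * (x * x) + b * b * (y * y)) + 0#
      ≈⟨ +-identityʳ _ ⟩
    a * a * (x * x + y * y) + (b * b * (x * x) + b * b * (y * y))
      ≈⟨ +-congˡ (distribˡ (b * b) (x * x) (y * y)) ⟨
    a * a * (x * x + y * y) + b * b * (x * x + y * y)
      ≈⟨ distribʳ _ (a * a) (b * b) ⟨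
    (a * a + b * b) * (x * x + y * y) ∎
    where
    e : a * x - b * y ≈ a * x + - b * y
    e = +-congˡ (-‿distribˡ-* b y)

  module CycleMatrix {n} .{{_ : NonZero n}} (next : Fin n → Fin n) (strong : Strong (functional next))
                     (w : Fin n → Carrier) (0<w : ∀ i → 0# < w i) where

    open Orbit next

    A : Matrix ℝ n
    A i j = if does (next i Fin.≟ j) then w i else 0#

    A·x≈ : ∀ (x : Fin n → Carrier) i → _·_ ℝ A x i ≈ w i * x (next i)
    A·x≈ x i = sum-single (next i) (w i) x

    ∏ : Fin n → ℕ → Carrier
    ∏ i zero    = 1#
    ∏ i (suc k) = w i * ∏ (next i) k

    ∏-pos : ∀ i k → 0# < ∏ i k
    ∏-pos i zero    = 0<1
    ∏-pos i (suc k) = *-pos (0<w i) (∏-pos (next i) k)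

    ∏≤1 : (∀ i → w i ≤ 1#) → ∀ i k → ∏ i k ≤ 1#
    ∏≤1 w≤1 i zero    = ≤-refl
    ∏≤1 w≤1 i (suc k) = ≤-respʳ-≈ (*-identityˡ 1#)
      (*-mono-≤ (<⇒≤ (0<w i)) 0≤1 (w≤1 i) (∏≤1 w≤1 (next i) k))

    ∏≤w : (∀ i → w i ≤ 1#) → ∀ i → ∏ i n ≤ w i
    ∏≤w w≤1 i = go n
      where
      go : ∀ m .{{_ : NonZero m}} → ∏ i m ≤ w i
      go (suc m) = ≤-respʳ-≈ (*-identityʳ (w i)) (*-monoʳ-≤ (<⇒≤ (0<w i)) (∏≤1 w≤1 (next i) m))

    -- Going once round the cycle, a factor is at least `q` or is charged to an entry of `T`, which
    -- is then struck off. Entries left over, and the `q` not earned at a charged vertex, only lower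
    -- the left-hand side because `q` and `c` are at most 1.
    ∏-lower : ∀ {v} {V : Set v} (vertex : Fin n → V) → Injective _≡_ _≡_ vertex →
      ∀ {q c} → 0# ≤ q → q ≤ 1# → 0# ≤ c → c ≤ 1# → ∀ (T : List V) →
      (∀ i → q ≤ w i ⊎ (c ≤ w i × vertex i ∈ T)) →
      ∀ i → q ^ n * c ^ List.length T ≤ ∏ i n
    ∏-lower {V = V} vertex vertex-injective {q} {c} 0≤q q≤1 0≤c c≤1 T bound i =
      go n T i (λ k _ → bound (step k i)) (step-injective strong i)
      where
      go : ∀ m (T : List V) i →
        (∀ k → k ℕ.< m → q ≤ w (step k i) ⊎ (c ≤ w (step k i) × vertex (step k i) ∈ T)) →
        (∀ {j k} → j ℕ.< m → k ℕ.< m → step j i ≡ step k i → j ≡ k) →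
        q ^ m * c ^ List.length T ≤ ∏ i m
      go zero    T i bound distinct = begin
        1# * c ^ List.length T ≈⟨ *-identityˡ _ ⟩
        c ^ List.length T      ≤⟨ ^-≤1 0≤c c≤1 (List.length T) ⟩
        1#                     ∎
      go (suc m) T i bound distinct with bound 0 (s≤s z≤n)
      ... | inj₁ q≤w = begin
        q * q ^ m * c ^ List.length T   ≈⟨ *-assoc _ _ _ ⟩
        q * (q ^ m * c ^ List.length T)
          ≤⟨ *-mono-≤ 0≤q (<⇒≤ (∏-pos (next i) m)) q≤w
              (go m T (next i) (λ k k<m → bound (suc k) (s≤s k<m)) (λ j<m k<m eq → ℕ.suc-injective (distinct (s≤s j<m) (s≤s k<m) eq))) ⟩
        w i * ∏ (next i) m              ∎
      ... | inj₂ (c≤w , i∈T) with remove i∈T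
      ...   | T′ , |T|≡1+|T′| , T∖i⊆T′ = begin
        q * q ^ m * c ^ List.length T    ≈⟨ *-congˡ (reflexive (≡.cong (c ^_) |T|≡1+|T′|)) ⟩
        q * q ^ m * (c * c ^ List.length T′) ≈⟨ x∙yz≈y∙xz _ _ _ ⟩
        c * (q * q ^ m * c ^ List.length T′) ≤⟨ *-monoʳ-≤ 0≤c (*-monoˡ-≤ (^-nonNeg 0≤c (List.length T′)) q*qᵐ≤qᵐ) ⟩
        c * (q ^ m * c ^ List.length T′)
          ≤⟨ *-mono-≤ 0≤c (<⇒≤ (∏-pos (next i) m)) c≤w
              (go m T′ (next i) bound′ (λ j<m k<m eq → ℕ.suc-injective (distinct (s≤s j<m) (s≤s k<m) eq))) ⟩
        w i * ∏ (next i) m               ∎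
        where
        q*qᵐ≤qᵐ : q * q ^ m ≤ q ^ m
        q*qᵐ≤qᵐ = ≤-respʳ-≈ (*-identityˡ _) (*-monoˡ-≤ (^-nonNeg 0≤q m) q≤1)

        bound′ : ∀ k → k ℕ.< m → q ≤ w (step k (next i)) ⊎ (c ≤ w (step k (next i)) × vertex (step k (next i)) ∈ T′)
        bound′ k k<m with bound (suc k) (s≤s k<m)
        ... | inj₁ q≤w         = inj₁ q≤w
        -- A later vertex differs from the current one, because fewer than a full round of steps
        -- separates them; so its entry survives the removal.
        ... | inj₂ (c≤w , k∈T) = inj₂ (c≤w , T∖i⊆T′ k∈T λ eq →
          ℕ.1+n≢0 (distinct (s≤s k<m) (s≤s z≤n) (vertex-injective eq)))

    -- Along the cycle w i · z (next i) = μ · z i, so going round once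
    -- gives ∏ w · z i = μⁿ · z i.

    eigenvalue⇒|μ|²ⁿ≈∏² : ∀ {a b} → IsEigenvalue ℝ A a b →
                          ∀ i → (a * a + b * b) ^ n ≈ ∏ i n * ∏ i n
    eigenvalue⇒|μ|²ⁿ≈∏² {a} {b} (x , y , z≉0 , Ax≈ , Ay≈) i = *-cancelˡ-≈ (|z|²≉0 i) (begin-equality
      |z|² i * |μ|² ^ n            ≈⟨ *-comm _ _ ⟩
      |μ|² ^ n * |z|² i            ≈⟨ along i n ⟨
      ∏ i n * ∏ i n * |z|² (step n i) ≈⟨ *-congˡ (reflexive (≡.cong |z|² (step-length strong i))) ⟩
      ∏ i n * ∏ i n * |z|² i          ≈⟨ *-comm _ _ ⟩
      |z|² i * (∏ i n * ∏ i n)        ∎)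
      where
      |μ|² = a * a + b * b

      |z|² : Fin n → Carrier
      |z|² i = x i * x i + y i * y i

      -- Passing to squared moduli turns the eigenvector equation into a real recursion, so that no
      -- powers of a complex number have to be formed.
      arc-step : ∀ i → w i * w i * |z|² (next i) ≈ |μ|² * |z|² i
      arc-step i = begin-equality
        w i * w i * |z|² (next i)
          ≈⟨ w²[x²+y²]≈[wx]²+[wy]² (w i) (x (next i)) (y (next i)) ⟩
        w i * x (next i) * (w i * x (next i)) + w i * y (next i) * (w i * y (next i))
          ≈⟨ +-cong (*-cong ex ex) (*-cong ey ey) ⟩
        (a * x i - b * y i) * (a * x i - b * y i) + (a * y i + b * x i) * (a * y i + b * x i)
          ≈⟨ |az|²≈|a|²|z|² a b (x i) (y i) ⟩
        |μ|² * |z|² i ∎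
        where
        ex = trans (sym (A·x≈ x i)) (Ax≈ i)
        ey = trans (sym (A·x≈ y i)) (Ay≈ i)

      along : ∀ i k → ∏ i k * ∏ i k * |z|² (step k i) ≈ |μ|² ^ k * |z|² i
      along i zero    = *-congʳ (*-identityˡ 1#)
      along i (suc k) = begin-equality
        w i * p * (w i * p) * |z|² (step k (next i))   ≈⟨ *-congʳ (*-interchange _ _ _ _) ⟩
        w i * w i * (p * p) * |z|² (step k (next i))   ≈⟨ *-assoc _ _ _ ⟩
        w i * w i * (p * p * |z|² (step k (next i)))   ≈⟨ *-congˡ (along (next i) k) ⟩
        w i * w i * (|μ|² ^ k * |z|² (next i))         ≈⟨ x∙yz≈y∙xz _ _ _ ⟩
        |μ|² ^ k * (w i * w i * |z|² (next i))         ≈⟨ *-congˡ (arc-step i) ⟩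
        |μ|² ^ k * (|μ|² * |z|² i)                     ≈⟨ x∙yz≈y∙xz _ _ _ ⟩
        |μ|² * (|μ|² ^ k * |z|² i)                     ≈⟨ *-assoc _ _ _ ⟨
        |μ|² * |μ|² ^ k * |z|² i                       ∎
        where p = ∏ (next i) k

      |z|²≉0 : ∀ i → ¬ |z|² i ≈ 0#
      |z|²≉0 i z≈0 = z≉0 λ j →
        x²+y²≈0⇒x≈0 (zero-everywhere j) , x²+y²≈0⇒x≈0 (trans (+-comm _ _) (zero-everywhere j))
        where
        zero-everywhere : ∀ j → |z|² j ≈ 0#
        zero-everywhere j with step-onto strong i j
        -- A zero of the eigenvector at `i` propagates to every vertex, as the weights along the way
        -- are nonzero.
        ... | k , _ , ≡.refl = x*y≈0⇒y≈0
          (λ p²≈0 → proj₂ (*-pos (∏-pos i k) (∏-pos i k)) (sym p²≈0))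
          (trans (along i k) (trans (*-congˡ z≈0) (zeroʳ _)))

    spectralRadius⇒rⁿ≈∏ : ∀ {r} → IsSpectralRadius ℝ A r → ∀ i → r ^ n ≈ ∏ i n
    spectralRadius⇒rⁿ≈∏ {r} (0≤r , (a , b , eigen , |μ|²≈r²) , _) i =
      x²≈y²⇒x≈y (^-nonNeg 0≤r n) (<⇒≤ (∏-pos i n)) (begin-equality
        r ^ n * r ^ n       ≈⟨ ^-distrib-* r r n ⟨
        (r * r) ^ n         ≈⟨ ^-congˡ n |μ|²≈r² ⟨
        (a * a + b * b) ^ n ≈⟨ eigenvalue⇒|μ|²ⁿ≈∏² eigen i ⟩
        ∏ i n * ∏ i n       ∎)

    module _ (i₀ : Fin n) {r} (0≤r : 0# ≤ r) (rⁿ≈∏ : r ^ n ≈ ∏ i₀ n) where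

      private
        d : Fin n → ℕ
        d j = proj₁ (step-onto strong j i₀)

        d<n : ∀ j → d j ℕ.< n
        d<n j = proj₁ (proj₂ (step-onto strong j i₀))

        step-d : ∀ j → step (d j) j ≡ i₀
        step-d j = proj₂ (proj₂ (step-onto strong j i₀))

        d-unique : ∀ j k → k ℕ.< n → step k j ≡ i₀ → d j ≡ k
        d-unique j k k<n eq = step-injective strong j (d<n j) k<n (≡.trans (step-d j) (≡.sym eq))

        -- Written without inverses; only the arc leaving i₀ needs rⁿ = ∏ i₀ n.

        x : Fin n → Carrier
        x j = r ^ (n ℕ.∸ d j) * ∏ j (d j)

        wx≈rx : ∀ j → w j * x (next j) ≈ r * x j
        wx≈rx j with d j in dj≡
        ... | suc k = begin-equality
          w j * (r ^ (n ℕ.∸ d (next j)) * ∏ (next j) (d (next j)))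
            ≈⟨ *-congˡ (reflexive (≡.cong (λ m → r ^ (n ℕ.∸ m) * ∏ (next j) m) d-next)) ⟩
          w j * (r ^ (n ℕ.∸ k) * ∏ (next j) k)
            ≈⟨ *-congˡ (*-congʳ (reflexive (≡.cong (r ^_) (n∸k≡1+n∸1+k)))) ⟩
          w j * (r * r ^ (n ℕ.∸ suc k) * ∏ (next j) k)
            ≈⟨ x∙yz≈y∙xz _ _ _ ⟩
          r * r ^ (n ℕ.∸ suc k) * (w j * ∏ (next j) k)
            ≈⟨ *-assoc _ _ _ ⟩
          r * (r ^ (n ℕ.∸ suc k) * (w j * ∏ (next j) k)) ∎
          where
          k<n : k ℕ.< n
          k<n = ℕ.<-trans (ℕ.n<1+n k) (≡.subst (ℕ._< n) dj≡ (d<n j))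

          d-next : d (next j) ≡ k
          d-next = d-unique (next j) k k<n (≡.subst (λ m → step m j ≡ i₀) dj≡ (step-d j))

          n∸k≡1+n∸1+k : n ℕ.∸ k ≡ suc (n ℕ.∸ suc k)
          n∸k≡1+n∸1+k = ℕ.+-∸-assoc 1 k<n
        -- Here `j` is `i₀` itself, and its successor is n - 1 steps away from `i₀`: the exponent of
        -- `r` drops from n to 1 while the product of all weights is completed, and `rⁿ≈∏` balances
        -- the two.
        ... | zero = at-base n ≡.refl
          where
          j≡i₀ : j ≡ i₀
          j≡i₀ = ≡.subst (λ m → step m j ≡ i₀) dj≡ (step-d j)

          at-base : ∀ m .{{_ : NonZero m}} → m ≡ n → w j * x (next j) ≈ r * (r ^ n * 1#)
          at-base (suc m) eq = begin-equality
            w j * x (next j)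
              ≈⟨ *-congˡ (reflexive (≡.cong (λ m → r ^ (n ℕ.∸ m) * ∏ (next j) m) d-next)) ⟩
            w j * (r ^ (n ℕ.∸ m) * ∏ (next j) m)
              ≈⟨ x∙yz≈y∙xz _ _ _ ⟩
            r ^ (n ℕ.∸ m) * (w j * ∏ (next j) m)
              ≈⟨ *-cong (trans (reflexive (≡.cong (r ^_) n∸m≡1)) (*-identityʳ r))
                        (reflexive (≡.cong₂ ∏ j≡i₀ eq)) ⟩
            r * ∏ i₀ n
              ≈⟨ *-congˡ rⁿ≈∏ ⟨
            r * r ^ n
              ≈⟨ *-congˡ (*-identityʳ _) ⟨
            r * (r ^ n * 1#) ∎
            where
            n∸m≡1 : n ℕ.∸ m ≡ 1
            n∸m≡1 = ≡.trans (≡.cong (ℕ._∸ m) (≡.sym eq)) (ℕ.m+n∸n≡m 1 m)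

            d-next : d (next j) ≡ m
            d-next = d-unique (next j) m (≡.subst (m ℕ.<_) eq (ℕ.n<1+n m))
              (≡.trans (≡.cong (λ m → step m j) eq) (≡.trans (step-length strong j) j≡i₀))

        x-base : ¬ x i₀ ≈ 0#
        x-base x≈0 = proj₂ (∏-pos i₀ n) (begin-equality
          0#                        ≈⟨ x≈0 ⟨
          r ^ (n ℕ.∸ d i₀) * ∏ i₀ (d i₀) ≈⟨ reflexive (≡.cong (λ m → r ^ (n ℕ.∸ m) * ∏ i₀ m) d-base) ⟩
          r ^ n * 1#                ≈⟨ *-identityʳ _ ⟩
          r ^ n                     ≈⟨ rⁿ≈∏ ⟩
          ∏ i₀ n                    ∎)
          where
          d-base : d i₀ ≡ 0
          d-base = d-unique i₀ 0 (ℕ.>-nonZero⁻¹ n) ≡.refl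

      isSpectralRadius : IsSpectralRadius ℝ A r
      isSpectralRadius = 0≤r , (r , 0# , eigen , trans (+-congˡ (zeroˡ 0#)) (+-identityʳ _)) , maximal
        where
        eigen : IsEigenvalue ℝ A r 0#
        eigen = x , (λ _ → 0#) , (λ x≈0 → x-base (proj₁ (x≈0 i₀)))
          , (λ i → trans (A·x≈ x i) (trans (wx≈rx i) (sym (trans (+-congˡ -0*0≈0) (+-identityʳ _)))))
          , (λ i → trans (A·x≈ _ i) (trans (zeroʳ _) (sym (trans (+-cong (zeroʳ r) (zeroˡ _)) (+-identityˡ 0#)))))
          where
          -0*0≈0 : - (0# * 0#) ≈ 0#
          -0*0≈0 = trans (-‿distribˡ-* 0# 0#) (zeroʳ _)

        maximal : ∀ a b → IsEigenvalue ℝ A a b → a * a + b * b ≤ r * r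
        maximal a b eigen′ = ^-cancel-≤ (+-nonNeg (x²-nonNeg a) (x²-nonNeg b)) (x²-nonNeg r) n (≤-reflexive (begin-equality
          (a * a + b * b) ^ n ≈⟨ eigenvalue⇒|μ|²ⁿ≈∏² eigen′ i₀ ⟩
          ∏ i₀ n * ∏ i₀ n     ≈⟨ *-cong rⁿ≈∏ rⁿ≈∏ ⟨
          r ^ n * r ^ n       ≈⟨ ^-distrib-* r r n ⟨
          (r * r) ^ n         ∎))

    -- `ProperCycleGap` contains 1 - r only for an actual spectral radius r. To show that gaps
    -- become small, a lower bound on hypothetical radii is therefore not enough.
    spectralRadius-exists : (∀ i → w i ≤ 1#) → Fin n → ∃[ r ] IsSpectralRadius ℝ A r
    spectralRadius-exists w≤1 i₀ with root n (<⇒≤ (∏-pos i₀ n)) (∏≤1 w≤1 i₀ n)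
    ... | r , 0≤r , rⁿ≈∏ = r , isSpectralRadius i₀ 0≤r rⁿ≈∏

-- Cycles of a digraph: properness, transversals and long cycles.

module _ {v a} {D : Digraph v a} where

  open Digraph D

  arcAt : (γ : Cycle D) → Fin (Cycle.length γ) → Arc
  arcAt γ i = Cycle.vertex γ i , Cycle.vertex γ (Cycle.next γ i) , Cycle.arc γ i

  base : (γ : Cycle D) → Fin (Cycle.length γ)
  base γ = go (Cycle.length γ) {{Cycle.nonempty γ}}
    where
    go : ∀ n .{{_ : NonZero n}} → Fin n
    go (suc n) = zero

  arcAt-injective : ∀ (γ : Cycle D) → Injective _≡_ _≡_ (arcAt γ)
  arcAt-injective γ eq = Cycle.injective γ (≡.cong proj₁ eq)

  -- When lengths are unbounded, every chosen cycle is proper: a still longer one supplies enough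
  -- arcs.
  shorter⇒proper : ∀ {γ γ′ : Cycle D} → Cycle.length γ ℕ.< Cycle.length γ′ → Proper γ
  shorter⇒proper {γ} {γ′} ℓ<ℓ′ = mk↣ {to = λ i → arcAt γ′ (Fin.inject≤ i ℓ<ℓ′)} λ eq →
    Fin.inject≤-injective ℓ<ℓ′ ℓ<ℓ′ _ _ (arcAt-injective γ′ eq)

  vertices : Cycle D → List Vertex
  vertices γ = List.tabulate (Cycle.vertex γ)

  module _ (em : ∀ {ℓ} → ExcludedMiddle ℓ) where

    Meets : Cycle D → List Vertex → Set v
    Meets γ T = ∃[ i ] Cycle.vertex γ i ∈ T

    meets-transversal : ∀ {T} → CycleTransversal D (_∈ T) → ∀ γ → Meets γ T
    meets-transversal {T} transversal γ with em {P = Meets γ T}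
    ... | yes meets = meets
    ... | no ¬meets = contradiction γ∖T transversal
      where
      open Cycle γ
      γ∖T : Cycle (D ∖ (_∈ T))
      γ∖T = record
        { length    = length
        ; nonempty  = nonempty
        ; vertex    = λ i → vertex i , [ (λ i∈T → ¬meets (i , i∈T)) ]
        ; injective = λ eq → injective (≡.cong value eq)
        ; next      = next
        ; arc       = arc
        ; strong    = strong
        }

    OnCycle : Cycle D → Vertex → Set v
    OnCycle γ u = ∃[ i ] Cycle.vertex γ i ≡ u

    -- If every arc leaving γ is an arc of γ, then strongness makes γ all of D.

    proper⇒exit : Strong D → ∀ (γ : Cycle D) → Proper γ →
      ∃[ i ] Σ (OutArc (Cycle.vertex γ i)) λ o → o ≢ proj₂ (arcAt γ i)
    proper⇒exit strong γ arcs with em {P = ∃[ i ] Σ (OutArc (Cycle.vertex γ i)) λ o → o ≢ proj₂ (arcAt γ i)}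
    ... | yes exit = exit
    ... | no ¬exit = contradiction (Fin.injective⇒≤ source-injective) (ℕ.<-irrefl ≡.refl)
      where
      open Cycle γ using (length; vertex; next)

      stays : ∀ i (o : OutArc (vertex i)) → o ≡ proj₂ (arcAt γ i)
      stays i o with em {P = o ≡ proj₂ (arcAt γ i)}
      ... | yes eq = eq
      ... | no neq = contradiction (i , o , neq) ¬exit

      closed : ∀ {u w} → OnCycle γ u → Star _⟶_ u w → OnCycle γ w
      closed on Star.ε = on
      closed (i , ≡.refl) (e ◅ p) = closed (next i , ≡.sym (≡.cong proj₁ (stays i (_ , e)))) p

      everywhere : ∀ u → OnCycle γ u
      everywhere u with em {P = vertex (base γ) ≡ u}
      ... | yes eq = base γ , eq
      ... | no neq = closed (base γ , ≡.refl) (strong _ _ neq)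

      everyArc : ∀ (x : Arc) → ∃[ i ] arcAt γ i ≡ x
      everyArc (u , o) with everywhere u
      ... | i , ≡.refl = i , ≡.cong (u ,_) (≡.sym (stays i o))

      source : Fin (suc length) → Fin length
      source k = proj₁ (everyArc (Injection.to arcs k))

      source-injective : Injective _≡_ _≡_ source
      source-injective {j} {k} eq = Injection.injective arcs
        (≡.trans (≡.sym (proj₂ (everyArc _))) (≡.trans (≡.cong (arcAt γ) eq) (proj₂ (everyArc _))))

    -- One arc of `γ′` is the extra arc, its source being off `γ`. Without a finite transversal such
    -- a `γ′` exists for every `γ`.
    disjoint⇒proper : ∀ {γ γ′ : Cycle D} →
      ¬ Meets γ′ (vertices γ) → Proper γ
    disjoint⇒proper {γ} {γ′} disjoint = mk↣ {to = arcs} arcs-injective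
      where
      arcs : Fin (suc (Cycle.length γ)) → Arc
      arcs zero    = arcAt γ′ (base γ′)
      arcs (suc i) = arcAt γ i

      new : ∀ i → ¬ Cycle.vertex γ′ (base γ′) ≡ Cycle.vertex γ i
      new i eq = disjoint (base γ′ , ≡.subst (_∈ vertices γ) (≡.sym eq) (∈-tabulate⁺ i))

      arcs-injective : Injective _≡_ _≡_ arcs
      arcs-injective {zero}  {zero}  eq = ≡.refl
      arcs-injective {zero}  {suc j} eq = contradiction (≡.cong proj₁ eq) (new j)
      arcs-injective {suc i} {zero}  eq = contradiction (≡.cong proj₁ (≡.sym eq)) (new i)
      arcs-injective {suc i} {suc j} eq = ≡.cong suc (arcAt-injective γ eq)

    avoiding-cycle : ¬ HasFiniteCycleTransversal D → ∀ T → ∃[ γ ] ¬ Meets γ T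
    avoiding-cycle ¬finite T with em {P = Cycle (D ∖ (_∈ T))}
    ... | no ¬cycle = contradiction (T , ¬cycle) ¬finite
    ... | yes γ = γ′ , λ (i , i∈T) → ∉T (vertex i) i∈T
      where
      open Cycle γ

      γ′ : Cycle D
      γ′ = record
        { length    = length
        ; nonempty  = nonempty
        ; vertex    = λ i → value (vertex i)
        ; injective = λ eq → injective (value-injective eq)
        ; next      = next
        ; arc       = arc
        ; strong    = strong
        }

      ∉T : (x : Digraph.Vertex (D ∖ (_∈ T))) → ¬ value x ∈ T
      ∉T (x , [ x∉T ]) x∈T = contradiction-irr x∉T (λ x∉T → x∉T x∈T)

    long-cycle : ¬ BoundedCycleLengths D → ∀ N → Σ (Cycle D) λ γ → N ℕ.< Cycle.length γ
    long-cycle unbounded N with em {P = Σ (Cycle D) λ γ → N ℕ.< Cycle.length γ}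
    ... | yes long = long
    ... | no ¬long = contradiction (N , λ γ → ℕ.≮⇒≥ λ N<ℓ → ¬long (γ , N<ℓ)) unbounded

-- A finite transversal and bounded lengths force a positive gap.

module Sufficiency (em : ∀ {ℓ} → ExcludedMiddle ℓ) (ℝ : CompleteOrderedField)
                   {v a} (D : Digraph v a) where

  open Digraph D
  open OrderedField em ℝ
  open Spectral em ℝ
  open ≤-Reasoning

  module Weighted (S : SubstochasticWeighting ℝ D) where

    open SubstochasticWeighting S

    w : Arc → Carrier
    w (_ , _ , e) = weight e

    w-pos : ∀ x → 0# < w x
    w-pos (_ , _ , e) = positive e

    private
      one : ∀ {u} → OutArc u → Fin 1 ↣ OutArc u
      one o = mk↣ {to = λ _ → o} λ { {zero} {zero} _ → ≡.refl }

      two : ∀ {u} {o o′ : OutArc u} → o ≢ o′ → Fin 2 ↣ OutArc u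
      two {o = o} {o′} o≢o′ = mk↣ {to = f} f-injective
        where
        f : Fin 2 → OutArc _
        f zero    = o
        f (suc _) = o′
        f-injective : Injective _≡_ _≡_ f
        f-injective {zero}     {zero}     _  = ≡.refl
        f-injective {zero}     {suc zero} eq = contradiction eq o≢o′
        f-injective {suc zero} {zero}     eq = contradiction (≡.sym eq) o≢o′
        f-injective {suc zero} {suc zero} _  = ≡.refl

    w≤1 : ∀ x → w x ≤ 1#
    w≤1 (u , o) = ≤-respˡ-≈ (+-identityʳ _) (substochastic u 1 (one o))

    w+w′≤1 : ∀ {u} {o o′ : OutArc u} → o ≢ o′ → w (u , o) + w (u , o′) ≤ 1#
    w+w′≤1 {u} o≢o′ = ≤-respˡ-≈ (+-congˡ (+-identityʳ _)) (substochastic u 2 (two o≢o′))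

    heavy-unique : ∀ {u} (o o′ : OutArc u) → ½ < w (u , o) → ½ < w (u , o′) → o ≡ o′
    heavy-unique {u} o o′ heavy heavy′ with em {P = o ≡ o′}
    ... | yes eq = eq
    ... | no neq = contradiction (w+w′≤1 neq) (<⇒≱ (begin-strict
      1#                      ≈⟨ ½+½≈1 ⟨
      ½ + ½                   ≤⟨ +-monoʳ-≤ ½ (<⇒≤ heavy′) ⟩
      ½ + w (u , o′)          <⟨ ≰⇒> (λ h → <⇒≱ heavy (+-cancelʳ-≤ _ h)) ⟩
      w (u , o) + w (u , o′)  ∎))

    proper⇒light : Strong D → ∀ (γ : Cycle D) → Proper γ → ∃[ i ] w (arcAt γ i) < 1#
    proper⇒light strong γ proper with proper⇒exit em strong γ proper
    ... | i , o , exit = i , ≰⇒> λ 1≤w → <⇒≱ (w-pos (_ , o)) (+-cancelʳ-≤ (w (arcAt γ i)) (begin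
      w (_ , o) + w (arcAt γ i) ≤⟨ w+w′≤1 exit ⟩
      1#                        ≤⟨ 1≤w ⟩
      w (arcAt γ i)             ≈⟨ +-identityˡ _ ⟨
      0# + w (arcAt γ i)        ∎))

    Heavy : Cycle D → Set
    Heavy γ = ∀ i → ½ < w (arcAt γ i)

    heavy-or-light : ∀ γ → Heavy γ ⊎ ∃[ i ] w (arcAt γ i) ≤ ½
    heavy-or-light γ with em {P = ∃[ i ] w (arcAt γ i) ≤ ½}
    ... | yes light = inj₂ light
    ... | no ¬light = inj₁ λ i → ≰⇒> λ w≤½ → ¬light (i , w≤½)

    -- From the common vertex on, `heavy-unique` makes both cycles leave along the same arc and so
    -- reach the same next vertex. This inclusion is the form in which uniqueness of the heavy cycle
    -- is used: it carries an arc of weight below 1 from one cycle to the other.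
    heavy-arcs⊆ : ∀ {γ γ′} → Heavy γ → Heavy γ′ → ∀ {i i′} →
      Cycle.vertex γ i ≡ Cycle.vertex γ′ i′ → ∀ j → ∃[ k ] arcAt γ′ k ≡ arcAt γ j
    heavy-arcs⊆ {γ} {γ′} heavy heavy′ {i} {i′} eq j with Orbit.step-onto (Cycle.next γ) (Cycle.strong γ) i j
    ... | m , _ , ≡.refl = follow m eq
      where
      same-arc : ∀ x y → ½ < w x → ½ < w y → proj₁ x ≡ proj₁ y → y ≡ x
      same-arc (u , o) (_ , o′) heavy heavy′ ≡.refl = ≡.cong (u ,_) (heavy-unique o′ o heavy′ heavy)

      follow : ∀ m {i i′} → Cycle.vertex γ i ≡ Cycle.vertex γ′ i′ →
               ∃[ k ] arcAt γ′ k ≡ arcAt γ (Orbit.step (Cycle.next γ) m i)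
      follow zero    {i} {i′} eq = i′ , same-arc _ _ (heavy i) (heavy′ i′) eq
      follow (suc m) {i} {i′} eq = follow m {Cycle.next γ i} {Cycle.next γ′ i′} (≡.sym
        (≡.cong (λ x → proj₁ (proj₂ x)) (same-arc (arcAt γ i) (arcAt γ′ i′) (heavy i) (heavy′ i′) eq)))

    LightBelow : Carrier → Cycle D → Set
    LightBelow β γ = ∃[ j ] w (arcAt γ j) ≤ β

    light-through-vertex : Strong D → ∀ t → ∃[ β ] ½ ≤ β × β < 1# ×
      (∀ γ → Proper γ → Meets em γ (t ∷ []) → LightBelow β γ)
    light-through-vertex strong t
      with em {P = Σ (Cycle D) λ γ → Proper γ × OnCycle em γ t × Heavy γ}
    ... | no none = ½ , ≤-refl , ½<1 , light
      where
      light : ∀ γ → Proper γ → Meets em γ (t ∷ []) → LightBelow ½ γ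
      light γ proper (i , here eq) with heavy-or-light γ
      ... | inj₁ heavy = contradiction (γ , proper , (i , eq) , heavy) none
      ... | inj₂ light = light
    ... | yes (γ* , proper* , (i* , eq*) , heavy*) with proper⇒light strong γ* proper*
    -- Being at least `½`, β covers cycles with an arc of weight at most `½`; being at least the
    -- weight of arc `j*`, it covers the heavy cycles through `t`, all of which contain that arc.
    ...   | j* , w*<1 with max ½ (w (arcAt γ* j*))
    ...     | β , ½≤β , w*≤β , lub = β , ½≤β , lub ½<1 w*<1 , light
      where
      light : ∀ γ → Proper γ → Meets em γ (t ∷ []) → LightBelow β γ
      light γ proper (i , here eq) with heavy-or-light γ
      ... | inj₂ (j , w≤½) = j , ≤-trans w≤½ ½≤β
      ... | inj₁ heavy with heavy-arcs⊆ {γ*} {γ} heavy* heavy {i*} {i} (≡.trans eq* (≡.sym eq)) j*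
      ...   | j , same = j , ≤-trans (≤-reflexive (reflexive (≡.cong w same))) w*≤β

    light-through : Strong D → ∀ T → ∃[ β ] ½ ≤ β × β < 1# ×
      (∀ γ → Proper γ → Meets em γ T → LightBelow β γ)
    light-through strong [] = ½ , ≤-refl , ½<1 , λ { _ _ (_ , ()) }
    light-through strong (t ∷ T) with light-through-vertex strong t | light-through strong T
    ... | β₁ , ½≤β₁ , β₁<1 , light₁ | β₂ , _ , β₂<1 , light₂ with max β₁ β₂
    ...   | β , β₁≤β , β₂≤β , lub = β , ≤-trans ½≤β₁ β₁≤β , lub β₁<1 β₂<1 , light
      where
      light : ∀ γ → Proper γ → Meets em γ (t ∷ T) → LightBelow β γ
      light γ proper (i , here eq) with light₁ γ proper (i , here eq)
      ... | j , w≤β₁ = j , ≤-trans w≤β₁ β₁≤β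
      light γ proper (i , there i∈T) with light₂ γ proper (i , i∈T)
      ... | j , w≤β₂ = j , ≤-trans w≤β₂ β₂≤β

    module Adjacency (γ : Cycle D) =
      CycleMatrix {{Cycle.nonempty γ}} (Cycle.next γ) (Cycle.strong γ)
        (λ i → w (arcAt γ i)) (λ i → w-pos (arcAt γ i))

    -- As r ≤ 1, raising the exponent from the length to `suc L` only decreases the power. The same
    -- ρ thus serves all cycles; `suc L` instead of `L` keeps the exponent positive.
    radius-bound : ∀ {β ρ L γ r} → β < 1# → 0# ≤ ρ → ρ ^ suc L ≈ β →
      Cycle.length γ ℕ.≤ L → LightBelow β γ →
      IsSpectralRadius ℝ (weightedAdjacency ℝ S γ) r → r ≤ ρ
    radius-bound {β} {ρ} {L} {γ} {r} β<1 0≤ρ ρᴸ≈β ℓ≤L (j , w≤β) radius =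
      ^-cancel-≤ 0≤r 0≤ρ (suc L) (begin
        r ^ suc L  ≤⟨ ^-antiʳ-≤ 0≤r r≤1 (ℕ.m≤n⇒m≤1+n ℓ≤L) ⟩
        r ^ length ≤⟨ rⁿ≤β ⟩
        β          ≈⟨ ρᴸ≈β ⟨
        ρ ^ suc L  ∎)
      where
      open Cycle γ using (length; nonempty)
      open Adjacency γ

      0≤r : 0# ≤ r
      0≤r = proj₁ radius

      rⁿ≤β : r ^ length ≤ β
      rⁿ≤β = begin
        r ^ length   ≈⟨ spectralRadius⇒rⁿ≈∏ radius j ⟩
        ∏ j length   ≤⟨ ∏≤w (λ i → w≤1 (arcAt γ i)) j ⟩
        w (arcAt γ j) ≤⟨ w≤β ⟩
        β            ∎

      r≤1 : r ≤ 1#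
      r≤1 = ^-cancel-≤ 0≤r 0≤1 length {{nonempty}} (begin
        r ^ length  ≤⟨ rⁿ≤β ⟩
        β           ≤⟨ <⇒≤ β<1 ⟩
        1#          ≈⟨ 1^n≈1 length ⟨
        1# ^ length ∎)

  bounded-below⇒positive-infimum : ∀ {p} (P : Pred Carrier p) {δ} → 0# < δ → (∀ x → P x → δ ≤ x) →
    ∃[ m ] IsInfimum P m × Strict._<⁺_ _<_ [ 0# ] m
  bounded-below⇒positive-infimum P {δ} 0<δ δ≤P with em {P = ∃ P}
  -- Without proper cycles the infimum is +∞, which counts as positive.
  ... | no empty = ⊤⁺ , ((λ x Px → contradiction (x , Px) empty) , (λ b _ → b ≤⊤⁺)) , Strict.[ 0# ]<⊤⁺
  -- The infimum is the supremum of the lower bounds. `True em` replaces the property of being a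
  -- lower bound, which lives at the level of `P`, by an equivalent `Set`-valued predicate, as
  -- `complete` requires.
  ... | yes (y , Py) with complete (λ b → True (em {P = ∀ x → P x → b ≤ x})) (δ , fromWitness δ≤P)
                                   (y , λ b b-lb → toWitness b-lb y Py)
  ...   | s , ub , lub = [ s ] , (lower , greatest) , Strict.[ <-≤-trans 0<δ (ub δ (fromWitness δ≤P)) ]
    where
    lower : ∀ x → P x → [ s ] ≤⁺ [ x ]
    lower x Px = [ lub x (λ b b-lb → toWitness b-lb x Px) ]

    greatest : ∀ b → (∀ x → P x → b ≤⁺ [ x ]) → b ≤⁺ [ s ]
    greatest ⊤⁺ ⊤⁺-lb with () ← ⊤⁺-lb y Py
    greatest [ b ] b-lb = [ ub b (fromWitness λ x Px → drop (b-lb x Px)) ]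
      where
      drop : ∀ {x y} → [ x ] ≤⁺ [ y ] → x ≤ y
      drop [ x≤y ] = x≤y

  transversal∧bounded⇒positive : Strong D → HasFiniteCycleTransversal D → BoundedCycleLengths D →
    ∀ (S : SubstochasticWeighting ℝ D) → PositiveProperCycleGap ℝ S
  transversal∧bounded⇒positive strong (T , transversal) (L , ℓ≤L) S
    with Weighted.light-through S strong T
  ... | β , ½≤β , β<1 , light with root (suc L) (≤-trans 0≤½ ½≤β) (<⇒≤ β<1)
  ...   | ρ , 0≤ρ , ρᴸ≈β = bounded-below⇒positive-infimum (ProperCycleGap ℝ S) (x<y⇒0<y-x ρ<1) λ
    { x (γ , proper , r , radius , x≈1-r) →
      ≤-respʳ-≈ (sym x≈1-r) (-‿monoʳ-≤ 1# (Weighted.radius-bound S {γ = γ} β<1 0≤ρ ρᴸ≈β (ℓ≤L γ)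
        (light γ proper (meets-transversal em transversal γ)) radius)) }
    where
    ρ<1 : ρ < 1#
    ρ<1 = ≰⇒> λ 1≤ρ → <⇒≱ β<1 (begin
      1#         ≈⟨ 1^n≈1 (suc L) ⟨
      1# ^ suc L ≤⟨ ^-monoˡ-≤ 0≤1 1≤ρ (suc L) ⟩
      ρ ^ suc L  ≈⟨ ρᴸ≈β ⟩
      β          ∎)

-- Failure of either condition yields a weighting without a positive gap.

module Necessity (em : ∀ {ℓ} → ExcludedMiddle ℓ) (ℝ : CompleteOrderedField)
                 {v a} (D : Digraph v a) where

  open Digraph D
  open OrderedField em ℝ
  open Spectral em ℝ
  open import Algebra.Properties.Semiring.Sum semiring using (*-distribˡ-sum; ∑-distrib-+)
  open ≤-Reasoning

  sum-mono-≤ : ∀ {n} {f g : Fin n → Carrier} → (∀ i → f i ≤ g i) → sum f ≤ sum g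
  sum-mono-≤ {zero}  f≤g = ≤-refl
  sum-mono-≤ {suc n} f≤g = +-mono-≤ (f≤g zero) (sum-mono-≤ (λ i → f≤g (suc i)))

  SubProbability : ∀ {b} {B : Set b} → (B → Carrier) → Set b
  SubProbability {B = B} f = ∀ n (xs : Fin n ↣ B) → sum (λ i → f (Injection.to xs i)) ≤ 1#

  -- The weights leaving a vertex are nested convex combinations, so their out-weight bounds all
  -- come from this lemma and from those for the pieces.
  mix : ∀ {b} {B : Set b} (f g : B → Carrier) {s t} → 0# ≤ s → 0# ≤ t → s + t ≈ 1# →
    SubProbability f → SubProbability g → SubProbability (λ x → s * f x + t * g x)
  mix f g {s} {t} 0≤s 0≤t s+t≈1 f-sub g-sub n xs = begin
    sum (λ i → s * f′ i + t * g′ i)             ≈⟨ ∑-distrib-+ (λ i → s * f′ i) (λ i → t * g′ i) ⟩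
    sum (λ i → s * f′ i) + sum (λ i → t * g′ i) ≈⟨ +-cong (*-distribˡ-sum s f′) (*-distribˡ-sum t g′) ⟨
    s * sum f′ + t * sum g′                     ≤⟨ +-mono-≤ (*-monoʳ-≤ 0≤s (f-sub n xs)) (*-monoʳ-≤ 0≤t (g-sub n xs)) ⟩
    s * 1# + t * 1#                             ≈⟨ +-cong (*-identityʳ s) (*-identityʳ t) ⟩
    s + t                                       ≈⟨ s+t≈1 ⟩
    1#                                          ∎
    where
    f′ = λ i → f (Injection.to xs i)
    g′ = λ i → g (Injection.to xs i)

  indicator : ∀ {p} {P : Set p} → Dec P → Carrier
  indicator P? = if does P? then 1# else 0#

  indicator-nonNeg : ∀ {p} {P : Set p} (P? : Dec P) → 0# ≤ indicator P?
  indicator-nonNeg (yes _) = 0≤1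
  indicator-nonNeg (no _)  = ≤-refl

  indicator-true : ∀ {p} {P : Set p} (P? : Dec P) → P → indicator P? ≈ 1#
  indicator-true (yes _) _ = refl
  indicator-true (no ¬p) p = contradiction p ¬p

  indicator-false : ∀ {p} {P : Set p} (P? : Dec P) → ¬ P → indicator P? ≈ 0#
  indicator-false (yes p) ¬p = contradiction p ¬p
  indicator-false (no _)  _  = refl

  indicator-sub : ∀ {b p} {B : Set b} {P : Pred B p} (P? : ∀ x → Dec (P x)) →
    (∀ {x y} → P x → P y → x ≡ y) → SubProbability (λ x → indicator (P? x))
  indicator-sub {B = B} {P} P? unique n xs = go n (Injection.to xs) (Injection.injective xs)
    where
    go : ∀ n (f : Fin n → B) → Injective _≡_ _≡_ f → sum (λ i → indicator (P? (f i))) ≤ 1#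
    go zero    f f-injective = 0≤1
    go (suc n) f f-injective with P? (f zero)
    ... | yes p = ≤-reflexive (trans (+-congˡ (sum-zero _ λ i → indicator-false (P? (f (suc i)))
                    λ p′ → Fin.0≢1+n (f-injective (unique p p′)))) (+-identityʳ 1#))
    ... | no  _ = ≤-respˡ-≈ (sym (+-identityˡ _)) (go n (λ i → f (suc i)) λ eq → Fin.suc-injective (f-injective eq))

  -- Serves twice: as the share of `γ m` in a distribution over all cycles, where the sum must not
  -- exceed 1, and as the fraction of out-weight that `γ m` gives up at the vertices where it is the
  -- first cycle.
  ε : ℕ → Carrier
  ε m = ½ ^ suc m

  0<ε : ∀ m → 0# < ε m
  0<ε m = ^-pos 0<½ (suc m)

  ε≤½ : ∀ m → ε m ≤ ½
  ε≤½ m = ≤-respʳ-≈ (*-identityʳ ½) (*-monoʳ-≤ 0≤½ (^-≤1 0≤½ ½≤1 m))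

  ε≤1 : ∀ m → ε m ≤ 1#
  ε≤1 m = ^-≤1 0≤½ ½≤1 (suc m)

  ε+ε≈½ᵐ : ∀ m → ε m + ε m ≈ ½ ^ m
  ε+ε≈½ᵐ m = trans (sym (distribʳ (½ ^ m) ½ ½)) (trans (*-congʳ ½+½≈1) (*-identityˡ _))

  q : ℕ → Carrier
  q m = 1# - ε m

  q+ε≈1 : ∀ m → q m + ε m ≈ 1#
  q+ε≈1 m = y-x+x≈y (ε m) 1#

  0<q : ∀ m → 0# < q m
  0<q m = x<y⇒0<y-x (≤-<-trans (ε≤½ m) ½<1)

  q<1 : ∀ m → q m < 1#
  q<1 m = ≰⇒> λ 1≤q → <⇒≱ (0<ε m) (+-cancelˡ-≤ (q m) (begin
    q m + ε m ≈⟨ q+ε≈1 m ⟩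
    1#        ≤⟨ 1≤q ⟩
    q m       ≈⟨ +-identityʳ _ ⟨
    q m + 0#  ∎))

  -- At a vertex first visited by an earlier `γ k`, the fraction `ε k`, at least `ε m`, goes to
  -- `S₁`; half of `S₁` is `spread`; and `spread` grants an arc of `γ m` at least `ε m`.
  c : ℕ → Carrier
  c m = ε m * (½ * ε m)

  0<c : ∀ m → 0# < c m
  0<c m = *-pos (0<ε m) (*-pos 0<½ (0<ε m))

  x*y≤1 : ∀ {x y} → 0# ≤ x → x ≤ 1# → y ≤ 1# → x * y ≤ 1#
  x*y≤1 0≤x x≤1 y≤1 = ≤-respʳ-≈ (*-identityˡ 1#) (*-mono-≤ 0≤x 0≤1 x≤1 y≤1)

  c≤1 : ∀ m → c m ≤ 1#
  c≤1 m = x*y≤1 (<⇒≤ (0<ε m)) (ε≤1 m) (x*y≤1 0≤½ ½≤1 (ε≤1 m))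

  1-q²≤½ᵐ : ∀ m → 1# - q m * q m ≤ ½ ^ m
  1-q²≤½ᵐ m = +-cancelʳ-≤ (q m * q m) (begin
    (1# - q m * q m) + q m * q m   ≈⟨ y-x+x≈y _ _ ⟩
    1#                             ≈⟨ q+ε≈1 m ⟨
    q m + ε m                      ≈⟨ +-congʳ (trans (sym (*-identityʳ _)) (trans (*-congˡ (sym (q+ε≈1 m))) (distribˡ _ _ _))) ⟩
    q m * q m + q m * ε m + ε m    ≤⟨ +-monoˡ-≤ (ε m) (+-monoʳ-≤ (q m * q m) qε≤ε) ⟩
    q m * q m + ε m + ε m          ≈⟨ +-assoc _ _ _ ⟩
    q m * q m + (ε m + ε m)        ≈⟨ +-congˡ (ε+ε≈½ᵐ m) ⟩
    q m * q m + ½ ^ m              ≈⟨ +-comm _ _ ⟩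
    ½ ^ m + q m * q m              ∎)
    where
    qε≤ε : q m * ε m ≤ ε m
    qε≤ε = ≤-respʳ-≈ (*-identityˡ (ε m)) (*-monoˡ-≤ (<⇒≤ (0<ε m)) (<⇒≤ (q<1 m)))

  -- In the second alternative the worst loss at `T`, one factor `c m` per entry, costs no more than
  -- another factor `q m ^ length`. This is the origin of the square in the bound (q m)² on the
  -- spectral radius.
  AlmostDisjoint : List Vertex → ℕ → Cycle D → Set v
  AlmostDisjoint T m γ = ¬ Meets em γ T ⊎ q m ^ Cycle.length γ ≤ c m ^ List.length T

  -- Excluded middle for all types provides witnesses, so that the cycles γ m
  -- below can be chosen by plain recursion.

  almostDisjoint-cycle : ¬ (HasFiniteCycleTransversal D × BoundedCycleLengths D) →
    ∀ T m → Σ (Cycle D) λ γ → Proper γ × AlmostDisjoint T m γ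
  almostDisjoint-cycle ¬both T m with em {P = HasFiniteCycleTransversal D}
  ... | no ¬finite with avoiding-cycle em ¬finite T
  ...   | γ , avoids with avoiding-cycle em ¬finite (vertices γ)
  ...     | γ′ , disjoint = γ , disjoint⇒proper em {γ} {γ′} disjoint , inj₁ avoids
  almostDisjoint-cycle ¬both T m | yes finite
    with ^-archimedean (0<q m) (q<1 m) (^-pos (0<c m) (List.length T))
  ... | n , qⁿ≤cᵀ with long-cycle em (λ bounded → ¬both (finite , bounded)) n
  ...   | γ , n<ℓ with long-cycle em (λ bounded → ¬both (finite , bounded)) (Cycle.length γ)
  ...     | γ′ , ℓ<ℓ′ = γ , shorter⇒proper {γ = γ} {γ′} ℓ<ℓ′ ,
    inj₂ (≤-trans (^-antiʳ-≤ (<⇒≤ (0<q m)) (<⇒≤ (q<1 m)) (ℕ.<⇒≤ n<ℓ)) qⁿ≤cᵀ)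

  -- The weighting built from the whole sequence of cycles.

  module Construction (S₀ : SubstochasticWeighting ℝ D)
    (pick : ∀ T m → Σ (Cycle D) λ γ → Proper γ × AlmostDisjoint T m γ) where

    used : ℕ → List Vertex
    γ    : ℕ → Cycle D

    used zero    = []
    used (suc m) = vertices (γ m) ++ used m
    γ m = proj₁ (pick (used m) m)

    γ-proper : ∀ m → Proper (γ m)
    γ-proper m = proj₁ (proj₂ (pick (used m) m))

    γ-almostDisjoint : ∀ m → AlmostDisjoint (used m) m (γ m)
    γ-almostDisjoint m = proj₂ (proj₂ (pick (used m) m))

    earlier⇒used : ∀ {k m u} → k ℕ.< m → OnCycle em (γ k) u → u ∈ used m
    earlier⇒used {k} {suc m} (s≤s k≤m) on with ℕ.m≤n⇒m<n∨m≡n k≤m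
    ... | inj₁ k<m = ∈-++⁺ʳ (vertices (γ m)) (earlier⇒used k<m on)
    earlier⇒used {k} {suc m} (s≤s k≤m) (i , ≡.refl) | inj₂ ≡.refl = ∈-++⁺ˡ (∈-tabulate⁺ i)

    module At (u : Vertex) where

      OnArc : ℕ → OutArc u → Set (v ⊔ a)
      OnArc m o = ∃[ i ] arcAt (γ m) i ≡ (u , o)

      OnArc-unique : ∀ m {o o′} → OnArc m o → OnArc m o′ → o ≡ o′
      OnArc-unique m (i , eq) (j , eq′)
        with ≡.refl ← Cycle.injective (γ m) {i} {j} (≡.trans (≡.cong proj₁ eq) (≡.sym (≡.cong proj₁ eq′)))
        with ≡.refl ← ≡.trans (≡.sym eq) eq′ = ≡.refl

      on : ℕ → OutArc u → Carrier
      on m o = indicator (em {P = OnArc m o})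

      on-nonNeg : ∀ m o → 0# ≤ on m o
      on-nonNeg m o = indicator-nonNeg (em {P = OnArc m o})

      on-sub : ∀ m → SubProbability (on m)
      on-sub m = indicator-sub (λ o → em {P = OnArc m o}) (OnArc-unique m)

      -- Truncations of ∑ₖ 2⁻ᵏ⁻¹ [ o ∈ γ (j + k) ]; these suffice to bound spread,
      -- as only finitely many arcs are summed over at a time.

      geometric : ℕ → ℕ → OutArc u → Carrier
      geometric zero    j o = 0#
      geometric (suc N) j o = ½ * on j o + ½ * geometric N (suc j) o

      geometric-nonNeg : ∀ N j o → 0# ≤ geometric N j o
      geometric-nonNeg zero    j o = ≤-refl
      geometric-nonNeg (suc N) j o =
        +-nonNeg (*-nonNeg 0≤½ (on-nonNeg j o)) (*-nonNeg 0≤½ (geometric-nonNeg N (suc j) o))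

      geometric-sub : ∀ N j → SubProbability (geometric N j)
      geometric-sub zero    j n xs = ≤-trans (≤-reflexive (sum-zero {n} (λ _ → 0#) λ _ → refl)) 0≤1
      geometric-sub (suc N) j = mix (on j) (geometric N (suc j)) 0≤½ 0≤½ ½+½≈1 (on-sub j) (geometric-sub N (suc j))

      ε≤geometric : ∀ {k N} j {o} → k ℕ.< N → OnArc (j ℕ.+ k) o → ε k ≤ geometric N j o
      ε≤geometric {zero} {suc N} j {o} _ o∈γ = begin
        ½ * 1#                                     ≈⟨ *-congˡ (indicator-true em o∈γ′) ⟨
        ½ * on j o                                 ≤⟨ x≤x+y _ (*-nonNeg 0≤½ (geometric-nonNeg N (suc j) o)) ⟩
        ½ * on j o + ½ * geometric N (suc j) o     ∎
        where
        o∈γ′ : OnArc j o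
        o∈γ′ = ≡.subst (λ m → OnArc m o) (ℕ.+-identityʳ j) o∈γ
      ε≤geometric {suc k} {suc N} j {o} (s≤s k<N) o∈γ = begin
        ½ * ε k                                    ≤⟨ *-monoʳ-≤ 0≤½ (ε≤geometric (suc j) k<N o∈γ′) ⟩
        ½ * geometric N (suc j) o                  ≤⟨ x≤y+x _ (*-nonNeg 0≤½ (on-nonNeg j o)) ⟩
        ½ * on j o + ½ * geometric N (suc j) o     ∎
        where
        o∈γ′ : OnArc (suc j ℕ.+ k) o
        o∈γ′ = ≡.subst (λ m → OnArc m o) (ℕ.+-suc j k) o∈γ

      firstArc? : ∀ o → Dec (∃ (IsFirst (λ k → OnArc k o)))
      firstArc? o = em

      spread′ : ∀ {o} → Dec (∃ (IsFirst (λ k → OnArc k o))) → Carrier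
      spread′ (yes (k , _)) = ε k
      spread′ (no _)        = 0#

      -- Only the largest term of the series over all cycles through `o`, namely that of the first
      -- one. This avoids infinite sums, and the term is still at least `ε m` for every `γ m`
      -- through `o`.
      spread : OutArc u → Carrier
      spread o = spread′ (firstArc? o)

      spread-nonNeg : ∀ o → 0# ≤ spread o
      spread-nonNeg o with firstArc? o
      ... | yes (k , _) = <⇒≤ (0<ε k)
      ... | no _        = ≤-refl

      spread≤geometric : ∀ o → ∃[ K ] ∀ {N} → K ℕ.≤ N → spread o ≤ geometric N 0 o
      spread≤geometric o with firstArc? o
      ... | yes (k , o∈γ , _) = suc k , λ k<N → ε≤geometric 0 k<N o∈γ
      ... | no _              = 0 , λ {N} _ → geometric-nonNeg N 0 o

      spread-sub : SubProbability spread
      spread-sub n xs with upperBound n (λ i → proj₁ (spread≤geometric (Injection.to xs i)))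
      ... | N , K≤N = ≤-trans
        (sum-mono-≤ λ i → proj₂ (spread≤geometric (Injection.to xs i)) (K≤N i))
        (geometric-sub N 0 n xs)

      ε≤spread : ∀ {m o} → OnArc m o → ε m ≤ spread o
      ε≤spread {m} {o} o∈γ with firstArc? o
      ... | yes (k , _ , k-first) = ^-antiʳ-≤ 0≤½ ½≤1 (s≤s (k-first m o∈γ))
      ... | no ¬first = contradiction (least _ (λ _ → em) (m , o∈γ)) ¬first

      -- One half reserves weight for every chosen cycle, also for those that come later; the half
      -- from `S₀` makes all arcs positive while respecting the out-weight bound at vertices of
      -- infinite out-degree.
      S₁ : OutArc u → Carrier
      S₁ o = ½ * spread o + ½ * SubstochasticWeighting.weight S₀ (proj₂ o)

      S₁-sub : SubProbability S₁
      S₁-sub = mix spread (λ o → SubstochasticWeighting.weight S₀ (proj₂ o)) 0≤½ 0≤½ ½+½≈1 spread-sub (SubstochasticWeighting.substochastic S₀ u)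

      S₁-pos : ∀ o → 0# < S₁ o
      S₁-pos o = <-≤-trans (*-pos 0<½ (SubstochasticWeighting.positive S₀ (proj₂ o)))
        (x≤y+x _ (*-nonNeg 0≤½ (spread-nonNeg o)))

      ½ε≤S₁ : ∀ {m o} → OnArc m o → ½ * ε m ≤ S₁ o
      ½ε≤S₁ {m} {o} o∈γ = ≤-trans (*-monoʳ-≤ 0≤½ (ε≤spread o∈γ))
        (x≤x+y _ (*-nonNeg 0≤½ (<⇒≤ (SubstochasticWeighting.positive S₀ (proj₂ o)))))

      firstCycle? : Dec (∃ (IsFirst (λ m → OnCycle em (γ m) u)))
      firstCycle? = em

      weight′ : Dec (∃ (IsFirst (λ m → OnCycle em (γ m) u))) → OutArc u → Carrier
      weight′ (yes (m , _)) o = q m * on m o + ε m * S₁ o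
      weight′ (no _)        o = S₁ o

      -- The first cycle through `u` takes almost all the out-weight. Later cycles through `u` must
      -- live on their shares of `S₁`, but for them `u` is a used vertex.
      weight : OutArc u → Carrier
      weight = weight′ firstCycle?

      weight-sub : SubProbability weight
      weight-sub with firstCycle?
      ... | yes (m , _) = mix (on m) S₁ (<⇒≤ (0<q m)) (<⇒≤ (0<ε m)) (q+ε≈1 m) (on-sub m) S₁-sub
      ... | no _        = S₁-sub

      weight-pos : ∀ o → 0# < weight o
      weight-pos o with firstCycle?
      ... | yes (m , _) = <-≤-trans (*-pos (0<ε m) (S₁-pos o)) (x≤y+x _ (*-nonNeg (<⇒≤ (0<q m)) (on-nonNeg m o)))
      ... | no _        = S₁-pos o

      weight-lower : ∀ {m o} → OnArc m o → q m ≤ weight o ⊎ (c m ≤ weight o × u ∈ used m)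
      weight-lower {m} {o} o∈γ@(i , eq) with firstCycle?
      ... | no ¬first = contradiction (least _ (λ _ → em) (m , i , ≡.cong proj₁ eq)) ¬first
      ... | yes (k , on-k , k-first) with ℕ.m≤n⇒m<n∨m≡n (k-first m (i , ≡.cong proj₁ eq))
      ...   | inj₂ ≡.refl = inj₁ (begin
        q k                        ≈⟨ *-identityʳ _ ⟨
        q k * 1#                   ≈⟨ *-congˡ (indicator-true em o∈γ) ⟨
        q k * on k o               ≤⟨ x≤x+y _ (*-nonNeg (<⇒≤ (0<ε k)) (<⇒≤ (S₁-pos o))) ⟩
        q k * on k o + ε k * S₁ o  ∎)
      ...   | inj₁ k<m = inj₂ ((begin
        ε m * (½ * ε m)            ≤⟨ *-mono-≤ (<⇒≤ (0<ε m)) (<⇒≤ (S₁-pos o)) (^-antiʳ-≤ 0≤½ ½≤1 (s≤s (ℕ.<⇒≤ k<m))) (½ε≤S₁ o∈γ) ⟩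
        ε k * S₁ o                 ≤⟨ x≤y+x _ (*-nonNeg (<⇒≤ (0<q k)) (on-nonNeg k o)) ⟩
        q k * on k o + ε k * S₁ o  ∎) , earlier⇒used k<m on-k)

    S : SubstochasticWeighting ℝ D
    S = record
      { weight        = λ {u} {w} e → At.weight u (w , e)
      ; positive      = λ {u} {w} e → At.weight-pos u (w , e)
      ; substochastic = λ u → At.weight-sub u
      }

    open Sufficiency em ℝ D using (module Weighted)
    open Weighted S using (w≤1; module Adjacency)

    ∏-bound : ∀ m → (q m * q m) ^ Cycle.length (γ m) ≤ Adjacency.∏ (γ m) (base (γ m)) (Cycle.length (γ m))
    ∏-bound m with γ-almostDisjoint m
    ... | inj₁ avoids = begin
      (q m * q m) ^ ℓ ≤⟨ ^-monoˡ-≤ (x²-nonNeg (q m)) q²≤q ℓ ⟩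
      q m ^ ℓ         ≈⟨ *-identityʳ _ ⟨
      -- `avoids` leaves no exceptional vertices: their list is `[]`, and the trailing `1#` is the
      -- empty power of their bound.
      q m ^ ℓ * 1#    ≤⟨ ∏-lower vertex injective (<⇒≤ (0<q m)) (<⇒≤ (q<1 m)) 0≤1 ≤-refl [] heavy (base (γ m)) ⟩
      ∏ (base (γ m)) ℓ ∎
      where
      open Cycle (γ m) renaming (length to ℓ)
      open Adjacency (γ m)

      q²≤q : q m * q m ≤ q m
      q²≤q = ≤-respʳ-≈ (*-identityʳ (q m)) (*-monoʳ-≤ (<⇒≤ (0<q m)) (<⇒≤ (q<1 m)))

      heavy : ∀ i → q m ≤ _ ⊎ (1# ≤ _ × vertex i ∈ [])
      heavy i with At.weight-lower (vertex i) {m} (i , ≡.refl)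
      ... | inj₁ q≤w      = inj₁ q≤w
      ... | inj₂ (_ , ∈T) = contradiction (i , ∈T) avoids
    ... | inj₂ qᴸ≤cᵀ = begin
      (q m * q m) ^ ℓ                     ≈⟨ ^-distrib-* (q m) (q m) ℓ ⟩
      q m ^ ℓ * q m ^ ℓ                   ≤⟨ *-monoʳ-≤ (^-nonNeg (<⇒≤ (0<q m)) ℓ) qᴸ≤cᵀ ⟩
      q m ^ ℓ * c m ^ List.length (used m) ≤⟨ ∏-lower vertex injective (<⇒≤ (0<q m)) (<⇒≤ (q<1 m)) (<⇒≤ (0<c m)) (c≤1 m)
                                               (used m) (λ i → At.weight-lower (vertex i) (i , ≡.refl)) (base (γ m)) ⟩
      ∏ (base (γ m)) ℓ                    ∎
      where
      open Cycle (γ m) renaming (length to ℓ)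
      open Adjacency (γ m)

    gap≤½ᵐ : ∀ m {r} → IsSpectralRadius ℝ (weightedAdjacency ℝ S (γ m)) r → 1# - r ≤ ½ ^ m
    gap≤½ᵐ m {r} radius = begin
      1# - r         ≤⟨ -‿monoʳ-≤ 1# q²≤r ⟩
      1# - q m * q m ≤⟨ 1-q²≤½ᵐ m ⟩
      ½ ^ m          ∎
      where
      ℓ = Cycle.length (γ m)

      q²≤r : q m * q m ≤ r
      q²≤r = ^-cancel-≤ (x²-nonNeg (q m)) (proj₁ radius) ℓ {{Cycle.nonempty (γ m)}} (begin
        (q m * q m) ^ ℓ                  ≤⟨ ∏-bound m ⟩
        Adjacency.∏ (γ m) (base (γ m)) ℓ ≈⟨ Adjacency.spectralRadius⇒rⁿ≈∏ (γ m) radius (base (γ m)) ⟨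
        r ^ ℓ                            ∎)

    abstract
      small-gap : ∀ m → ∃[ x ] ProperCycleGap ℝ S x × x ≤ ½ ^ m
      small-gap m =
        let r , radius = Adjacency.spectralRadius-exists (γ m) (λ i → w≤1 (arcAt (γ m) i)) (base (γ m))
        in 1# - r , (γ m , γ-proper m , r , radius , refl) , gap≤½ᵐ m radius

    ¬positive : ¬ PositiveProperCycleGap ℝ S
    -- A power of `½` below δ/2 yields a gap below δ/2, so δ ≤ δ/2 for the supposed infimum δ.
    ¬positive (_ , (lower , _) , Strict.[ 0<δ ]) with ^-archimedean 0<½ ½<1 (*-pos 0<½ 0<δ)
    ... | n , ½ⁿ≤½δ with small-gap n
    ...   | x , x∈gap , x≤½ⁿ with lower x x∈gap
    ...     | [ δ≤x ] = <⇒≱ 0<δ (x≤ρx⇒x≤0 ½<1 (≤-trans δ≤x (≤-trans x≤½ⁿ ½ⁿ≤½δ)))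
    -- The infimum cannot be +∞ either, since the set of gaps is inhabited.
    ¬positive (_ , (lower , _) , Strict.[ _ ]<⊤⁺) with small-gap 0
    ... | x , x∈gap , _ with () ← lower x x∈gap

proposition2 :
    (∀ {ℓ} → ExcludedMiddle ℓ) →
    (ℝ : CompleteOrderedField) →
    ∀ {v a} (D : Digraph v a) →
    Strong D →
    SubstochasticWeighting ℝ D →
    (∀ (S : SubstochasticWeighting ℝ D) → PositiveProperCycleGap ℝ S)
      ⇔ (HasFiniteCycleTransversal D × BoundedCycleLengths D)
proposition2 em ℝ D strong S₀ = mk⇔
  (λ positive → decidable-stable em λ ¬both →
    let open Necessity.Construction em ℝ D S₀ (Necessity.almostDisjoint-cycle em ℝ D ¬both)
    in ¬positive (positive S))
  (λ (finite , bounded) → Sufficiency.transversal∧bounded⇒positive em ℝ D strong finite bounded)
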